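{- There is a function $f:\mathbb N^3\to\mathbb N$ such that for every prime power $q$ and all conformal matrices $A$ and $B$ over $\mathbb F_q$ (i.e. the number of columns of $A$ equals the number of rows of $B$), the product $AB$ computed over $\mathbb F_q$ has twin-width at most $f(\mathrm{tww}(A),\mathrm{tww}(B),q)$.
   Context: A matrix $M$ over a finite alphabet $A$ with row set $R$ and column set $C$ is identified with the ordered binary structure on $R\uplus C$ with a unary relation for rows, a total order extending the row and column orders with rows before columns, and for each $a\in A$ a binary relation $E_a(r,c)$ holding iff $r\in R$, $c\in C$, $M[r,c]=a$. Twin-width $\mathrm{tww}$: a contraction sequence is a sequence of partitions of the domain from singletons to a single part, each obtained from the previous one by merging two parts; two distinct parts $X,Y$ are red-adjacent if some $u,u'\in X$, $v,v'\in Y$ give pairs $(u,v)$, $(u',v')$ of different atomic types (atomic type: the unary relations containing each element and the binary relations containing $(u,v)$ and $(v,u)$); the twin-width is the least $d$ such that some contraction sequence has, at every step, every part red-adjacent to at most $d$ others. -}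

module Defs where

open import Data.Nat using (ℕ; zero; suc; _+_; _∸_; _≤_; _<_; _^_)
open import Data.Nat.Primality using (Prime)
open import Data.Fin using (Fin; toℕ; _↑ˡ_; _↑ʳ_; splitAt)
import Data.Fin as F
open import Data.Bool using (Bool; true; false)
open import Data.Maybe using (Maybe; just; nothing)
open import Data.Sum using (_⊎_; inj₁; inj₂)
open import Data.Product using (Σ; ∃; ∃-syntax; _×_; _,_)
open import Data.List using (List; length; foldr; map)
open import Data.List.Membership.Propositional using (_∈_)
open import Data.Fin.Base using ()
open import Relation.Nullary using (¬_; does)
open import Relation.Binary.PropositionalEquality using (_≡_; _≢_)
open import Algebra.Structures using (IsCommutativeRing)
open import Algebra.Core using (Op₁; Op₂)
open import Data.List using (allFin)

IsPrimePower : ℕ → Set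
IsPrimePower q = ∃[ p ] ∃[ k ] (Prime p × q ≡ p ^ suc k)

-- A field structure whose carrier is Fin q (with propositional equality).
-- Every finite field of order q is isomorphic to one of these.
record FiniteField (q : ℕ) : Set where
  field
    _+F_ : Op₂ (Fin q)
    _*F_ : Op₂ (Fin q)
    -F_  : Op₁ (Fin q)
    0F   : Fin q
    1F   : Fin q
    isCommutativeRing : IsCommutativeRing _≡_ _+F_ _*F_ -F_ 0F 1F
    0≢1  : 0F ≢ 1F
    inverse : ∀ x → x ≢ 0F → ∃[ y ] (x *F y ≡ 1F)

Matrix : Set → ℕ → ℕ → Set
Matrix A m n = Fin m → Fin n → A

_⊗[_]_ : ∀ {q m n p} → Matrix (Fin q) m n → FiniteField q → Matrix (Fin q) n p
        → Matrix (Fin q) m p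
(A ⊗[ 𝔽 ] B) i j = foldr _+F_ 0F (map (λ k → A i k *F B k j) (allFin _))
  where open FiniteField 𝔽

-- The ordered binary structure of a matrix on R ⊎ C, encoded as Fin (m + n):
-- element  r ↑ˡ n  is row r,  m ↑ʳ c  is column c; the natural order of
-- Fin (m + n) extends row and column orders with rows before columns.

isRow : ∀ {m n} → Fin (m + n) → Bool
isRow {m} {n} x with splitAt m x
... | inj₁ _ = true
... | inj₂ _ = false

-- the letter a with E_a(x , y), if any
entry : ∀ {A : Set} {m n} → Matrix A m n → Fin (m + n) → Fin (m + n) → Maybe A
entry {m = m} M x y with splitAt m x | splitAt m y
... | inj₁ r | inj₂ c = just (M r c)
... | _      | _      = nothing

-- Atomic type of the pair (x , y): unary relation (Row) on x and y,
-- order relation in both directions, E_a relations in both directions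
-- (the E_a for all a are encoded by the letter they hold for, if any).
AtomicType : Set → Set
AtomicType A = Bool × Bool × Bool × Bool × Maybe A × Maybe A

atp : ∀ {A : Set} {m n} → Matrix A m n → Fin (m + n) → Fin (m + n) → AtomicType A
atp {m = m} {n} M x y = isRow {m} {n} x , isRow {m} {n} y , does (x F.<? y) , does (y F.<? x) , entry M x y , entry M y x

-- Partitions of Fin N given by a labelling: x, y in the same part iff
-- same label.

Partition : ℕ → Set
Partition N = Fin N → ℕ

Discrete : ∀ {N} → Partition N → Set
Discrete P = ∀ x y → P x ≡ P y → x ≡ y

Trivial : ∀ {N} → Partition N → Set
Trivial P = ∀ x y → P x ≡ P y

MergeOf : ∀ {N} → Partition N → Partition N → Set
MergeOf {N} P Q = ∃[ a ] ∃[ b ] (P a ≢ P b × (∀ x y → (Q x ≡ Q y) ⇔ SameAfter a b x y))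
  where
    _⇔_ : Set → Set → Set
    S ⇔ T = (S → T) × (T → S)
    SameAfter : Fin N → Fin N → Fin N → Fin N → Set
    SameAfter a b x y = P x ≡ P y
                      ⊎ (P x ≡ P a × P y ≡ P b)
                      ⊎ (P x ≡ P b × P y ≡ P a)

RedAdj : ∀ {A : Set} {m n} → Matrix A m n → Partition (m + n)
       → Fin (m + n) → Fin (m + n) → Set
RedAdj M P x y = P x ≢ P y × ∃[ u ] ∃[ u' ] ∃[ v ] ∃[ v' ]
  (P u ≡ P x × P u' ≡ P x × P v ≡ P y × P v' ≡ P y × atp M u v ≢ atp M u' v')

RedDegreeAtMost : ∀ {A : Set} {m n} → Matrix A m n → Partition (m + n) → ℕ → Set
RedDegreeAtMost {m = m} {n} M P d = ∀ x → ∃[ L ] (length L ≤ d ×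
  (∀ y → RedAdj M P x y → ∃[ z ] (z ∈ L × P z ≡ P y)))

record ContractionSeq {A : Set} {m n} (M : Matrix A m n) (d : ℕ) : Set where
  field
    P      : ℕ → Partition (m + n)
    start  : Discrete (P 0)
    step   : ∀ i → suc i < m + n → MergeOf (P i) (P (suc i))
    finish : Trivial (P ((m + n) ∸ 1))
    width  : ∀ i → i < m + n → RedDegreeAtMost M (P i) d

TwwAtMost : ∀ {A : Set} {m n} → Matrix A m n → ℕ → Set
TwwAtMost M d = ContractionSeq M d

TwwIs : ∀ {A : Set} {m n} → Matrix A m n → ℕ → Set
TwwIs M d = TwwAtMost M d × (∀ d' → TwwAtMost M d' → d ≤ d')

module Submission where

-- A division groups the rows, or the columns, into intervals; a group of rows is poor when it
-- realises boundedly many vectors outside boundedly many column intervals.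
--
-- Run a contraction sequence of a matrix against divisions of its rows and columns.  When a part
-- first stretches across a row interval, boundedly many parts meet that interval, so it is poor
-- unless one of them is red-adjacent to a part that touches many column intervals.  Such parts are
-- scarce, and an amortised count shows that a matrix of bounded twin-width has few exceptional
-- row intervals relative to the number of column intervals.
--
-- Hence, for A and B with divisions of the rows of A, of the inner index and of the columns of B,
-- there are two consecutive intervals on the largest of the three sides whose merger is again poor
-- in all the matrices concerned, and everything can be merged down keeping all intervals poor.
-- Poor intervals of A and B compose: over a finite field the remaining contribution to A B is a
-- bounded tuple of sums.  Finally, a sequence of divisions of A B into poor intervals becomes a
-- contraction sequence by identifying two rows of an interval that agree on all cells with few
-- distinct rows and few distinct columns.

open import Defs
open import Data.Nat using (ℕ; zero; suc; _+_; _*_; _∸_; _^_; _≤_; _<_; z≤n; s≤s; _≤?_; _<?_; ⌊_/2⌋; pred)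
import Data.Nat as N
open import Data.Nat.Properties hiding (_≟_)
import Data.Nat.Tactic.RingSolver as NS
open import Data.Fin using (Fin; zero; suc; toℕ; splitAt; join; _↑ˡ_; _↑ʳ_; combine; remQuot; funToFin; finToFun; fromℕ<; punchIn; punchOut)
import Data.Fin as F
import Data.Fin.Properties as FP
open import Data.Bool using (Bool; true; false; if_then_else_)
import Data.Bool as B
import Data.Bool.Properties as BP
open import Data.Maybe using (Maybe; just; nothing)
import Data.Maybe.Properties as MP
open import Data.Sum using (_⊎_; inj₁; inj₂; [_,_]′)
import Data.Sum as S
import Data.Sum.Properties as SP
open import Data.Product using (swap; Σ; ∃-syntax; Σ-syntax; _×_; _,_; proj₁; proj₂)
import Data.Product.Properties as PP
open import Data.List using (List; filter; []; _∷_; length; _++_; map; foldr; allFin; tabulate)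
open import Data.List.Membership.Propositional using (_∈_; _∉_; find; lose)
open import Data.List.Membership.Propositional.Properties using (∈-++⁺ˡ; ∈-++⁺ʳ; ∈-tabulate⁺; ∈-filter⁺; ∈-map⁺)
import Data.List.Membership.DecPropositional as DM
import Data.List.Properties as LP
open import Data.List.Relation.Unary.Any as Any using (Any; here; there; any?)
open import Data.Empty using (⊥; ⊥-elim)
open import Data.Unit using (⊤; tt)
open import Relation.Nullary using (¬_; Dec; yes; no; does)
open import Relation.Nullary.Decidable using (_×-dec_; _⊎-dec_; _→-dec_; ¬?; decidable-stable; dec-true; dec-false; map′)
open import Relation.Binary.PropositionalEquality using (_≡_; _≢_; refl; sym; trans; cong; cong₂; subst; subst₂; module ≡-Reasoning)
open import Function using (_∘_; id; case_of_)
open import Algebra.Bundles using (Semiring)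
open import Algebra.Structures using (module IsCommutativeRing)
import Algebra.Properties.Semiring.Sum
open import Relation.Binary.Definitions using (tri<; tri≈; tri>)

-- Counting below a bound, least and greatest elements, and codes of finite tables.

sumN : ℕ → (ℕ → ℕ) → ℕ
sumN zero    f = 0
sumN (suc s) f = f s + sumN s f

sumN-mono : ∀ s {f g} → (∀ j → j < s → f j ≤ g j) → sumN s f ≤ sumN s g
sumN-mono zero    h = z≤n
sumN-mono (suc s) h =
  +-mono-≤ (h s ≤-refl) (sumN-mono s λ j j<s → h j (m≤n⇒m≤1+n j<s))

sumN-+ : ∀ s f g → sumN s (λ j → f j + g j) ≡ sumN s f + sumN s g
sumN-+ zero    f g = refl
sumN-+ (suc s) f g rewrite sumN-+ s f g = interchange (f s) (g s) (sumN s f) (sumN s g)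
  where
  interchange : ∀ a b c d → (a + b) + (c + d) ≡ (a + c) + (b + d)
  interchange = NS.solve-∀

sumN-const : ∀ s k → sumN s (λ _ → k) ≡ s * k
sumN-const zero    k = refl
sumN-const (suc s) k = cong (k +_) (sumN-const s k)

ind : ∀ {P : Set} → Dec P → ℕ
ind (yes _) = 1
ind (no _)  = 0

ind-mono : ∀ {P Q : Set} (p? : Dec P) (q? : Dec Q) → (P → Q) → ind p? ≤ ind q?
ind-mono (yes p) (yes q) f = ≤-refl
ind-mono (yes p) (no ¬q) f = ⊥-elim (¬q (f p))
ind-mono (no ¬p) q?      f = z≤n

ind-⊎ : ∀ {P Q R : Set} (p? : Dec P) (q? : Dec Q) (r? : Dec R) → (P → Q ⊎ R) → ind p? ≤ ind q? + ind r?
ind-⊎ (no _)  _       _       _ = z≤n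
ind-⊎ (yes _) (yes _) _       _ = s≤s z≤n
ind-⊎ (yes _) (no _)  (yes _) _ = s≤s z≤n
ind-⊎ (yes p) (no ¬q) (no ¬r) f = ⊥-elim ([ ¬q , ¬r ]′ (f p))

sumN-≡ : ∀ s a → sumN s (λ j → ind (j N.≟ a)) ≤ 1
sumN-≡ zero a = z≤n
sumN-≡ (suc s) a with s N.≟ a
... | no _ = sumN-≡ s a
... | yes refl = ≤-reflexive (cong suc (absent s ≤-refl))
  where
  absent : ∀ t → t ≤ s → sumN t (λ j → ind (j N.≟ s)) ≡ 0
  absent zero _ = refl
  absent (suc t) t<s with t N.≟ s
  ... | yes refl = ⊥-elim (<-irrefl refl t<s)
  ... | no _ = absent t (<⇒≤ t<s)

enumerate : ∀ s {P : ℕ → Set} (P? : ∀ j → Dec (P j)) →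
  ∃[ L ] (length L ≡ sumN s (λ j → ind (P? j)) × (∀ j → j < s → P j → j ∈ L))
enumerate zero P? = [] , refl , λ _ ()
enumerate (suc s) P? with enumerate s P? | P? s
... | L , eq , all | yes p = s ∷ L , cong suc eq , λ j j<1+s pj → case m<1+n⇒m<n∨m≡n j<1+s of λ
  { (inj₁ j<s) → there (all j j<s pj) ; (inj₂ refl) → here refl }
... | L , eq , all | no ¬p = L , eq , λ j j<1+s pj → case m<1+n⇒m<n∨m≡n j<1+s of λ
  { (inj₁ j<s) → all j j<s pj ; (inj₂ refl) → ⊥-elim (¬p pj) }

pad : ∀ {A : Set} {k} → A → (L : List A) → length L ≤ k → Σ[ Y ∈ (Fin k → A) ] (∀ {x} → x ∈ L → ∃[ l ] (Y l ≡ x))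
pad {A} {k} a L le = f k L , complete L le
  where
  f : ∀ k → List A → Fin k → A
  f k       []      _       = a
  f (suc k) (x ∷ L) zero    = x
  f (suc k) (x ∷ L) (suc l) = f k L l
  complete : ∀ {k} L → length L ≤ k → ∀ {x} → x ∈ L → ∃[ l ] (f k L l ≡ x)
  complete (x ∷ L) (s≤s le) (here refl) = zero , refl
  complete (x ∷ L) (s≤s le) (there x∈L) with complete L le x∈L
  ... | l , eq = suc l , eq

first? : ∀ {n} {P : Fin n → Set} → (∀ x → Dec (P x)) →
  (∀ x → ¬ P x) ⊎ ∃[ x ] (P x × (∀ y → P y → toℕ x ≤ toℕ y))
first? {zero}  P? = inj₁ λ ()
first? {suc n} P? with P? zero | first? (P? ∘ suc)
... | yes p | _ = inj₂ (zero , p , λ _ _ → z≤n)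
... | no ¬p | inj₁ none = inj₁ λ { zero → ¬p ; (suc x) → none x }
... | no ¬p | inj₂ (x , p , least) =
  inj₂ (suc x , p , λ { zero q → ⊥-elim (¬p q) ; (suc y) q → s≤s (least y q) })

last? : ∀ {n} {P : Fin n → Set} → (∀ x → Dec (P x)) →
  (∀ x → ¬ P x) ⊎ ∃[ x ] (P x × (∀ y → P y → toℕ y ≤ toℕ x))
last? {zero}  P? = inj₁ λ ()
last? {suc n} P? with last? (P? ∘ suc) | P? zero
... | inj₂ (x , p , greatest) | _ =
  inj₂ (suc x , p , λ { zero _ → z≤n ; (suc y) q → s≤s (greatest y q) })
... | inj₁ none | yes p =
  inj₂ (zero , p , λ { zero _ → z≤n ; (suc y) q → ⊥-elim (none y q) })
... | inj₁ none | no ¬p = inj₁ λ { zero → ¬p ; (suc x) → none x }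

Monotone : ∀ {n} → (Fin n → ℕ) → Set
Monotone ρ = ∀ {x y} → toℕ x ≤ toℕ y → ρ x ≤ ρ y

monotone-reflects-< : ∀ {n} {ρ : Fin n → ℕ} → Monotone ρ → ∀ {x y} → ρ x < ρ y → toℕ x < toℕ y
monotone-reflects-< mono {x} {y} lt with toℕ y ≤? toℕ x
... | yes le = ⊥-elim (<⇒≱ lt (mono le))
... | no nle = ≰⇒> nle

-- `Poor` wants its removed labels as one family over a single `Fin`; this packs a family with three
-- indices into that form. The last `k` slots hold the dummy label 0 and pad the family to a
-- prescribed size.
flatten : ∀ a b c k → (f : Fin a → Fin b → Fin c → ℕ) →
  Σ[ Y ∈ (Fin (a * b * c + k) → ℕ) ] (∀ i j l → ∃[ z ] (Y z ≡ f i j l))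
flatten a b c k f = Y , λ i j l → combine (combine i j) l ↑ˡ k , hit i j l
  where
  Y : Fin (a * b * c + k) → ℕ
  Y = [ (λ z → f′ (remQuot {a * b} c z)) , (λ _ → 0) ]′ ∘ splitAt (a * b * c)
    where
    f′ : Fin (a * b) × Fin c → ℕ
    f′ (ij , l) = f (proj₁ (remQuot {a} b ij)) (proj₂ (remQuot {a} b ij)) l
  hit : ∀ i j l → Y (combine (combine i j) l ↑ˡ k) ≡ f i j l
  hit i j l = trans (cong [ _ , _ ]′ (FP.splitAt-↑ˡ (a * b * c) (combine (combine i j) l) k))
    (trans (cong (λ (ij , l) → f (proj₁ (remQuot {a} b ij)) (proj₂ (remQuot {a} b ij)) l)
        (FP.remQuot-combine {a * b} {c} (combine i j) l))
      (cong (λ (i , j) → f i j l) (FP.remQuot-combine {a} {b} i j)))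

funToFin-injective : ∀ {k q} (f g : Fin k → Fin q) → funToFin f ≡ funToFin g → ∀ i → f i ≡ g i
funToFin-injective f g eq i =
  trans (sym (FP.finToFun-funToFin f i)) (trans (cong (λ c → finToFun c i) eq) (FP.finToFun-funToFin g i))

-- The class map of `Poor` lands in a single `Fin`. Rows get classified by an index together with a
-- finite table, and equal codes return equality of both.
tableCode : ∀ {u a b q} → Fin u → (Fin a → Fin b → Fin q) → Fin (u * q ^ (a * b))
tableCode {u} {a} {b} k f = combine k (funToFin {a * b} λ ij → f (proj₁ (remQuot {a} b ij)) (proj₂ (remQuot {a} b ij)))

tableCode-injective : ∀ {u a b q} (k k′ : Fin u) (f f′ : Fin a → Fin b → Fin q) → tableCode k f ≡ tableCode k′ f′ →
  k ≡ k′ × (∀ i j → f i j ≡ f′ i j)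
tableCode-injective {u} {a} {b} k k′ f f′ eq =
  FP.combine-injectiveˡ k _ k′ _ eq ,
  λ i j → subst (λ (i , j) → f i j ≡ f′ i j) (FP.remQuot-combine {a} {b} i j)
    (funToFin-injective {a * b} _ _ (FP.combine-injectiveʳ k _ k′ _ eq) (combine i j))

-- Contraction sequences

-- A contraction sequence with rows and columns on an equal footing, so that it can be transposed.
-- Every list of red neighbours also contains the part itself.
record Sequence {q m n} (A : Matrix (Fin q) m n) (e : ℕ) : Set where
  field
    T : ℕ
    P : ℕ → Fin m ⊎ Fin n → ℕ
    discrete : ∀ {x y} → P 0 x ≡ P 0 y → x ≡ y
    coarsen  : ∀ {t} → t < T → ∀ {x y} → P t x ≡ P t y → P (suc t) x ≡ P (suc t) y
    merge    : ∀ {t} → t < T → ∃[ a ] ∃[ b ] (P t a ≢ P t b × P (suc t) a ≡ P (suc t) b ×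
      (∀ x y → P (suc t) x ≡ P (suc t) y →
        P t x ≡ P t y ⊎ (P t x ≡ P t a × P t y ≡ P t b) ⊎ (P t x ≡ P t b × P t y ≡ P t a)))
    total    : ∀ x y → P T x ≡ P T y

  Near : ∀ {k} → ℕ → (Fin k → Fin m ⊎ Fin n) → Fin m ⊎ Fin n → Set
  Near t L y = ∃[ k ] (P t (L k) ≡ P t y)

  field
    near : ∀ {t} → t ≤ T → ∀ x → Σ[ L ∈ (Fin e → Fin m ⊎ Fin n) ]
      ( Near t L x
      × (∀ c → Near t L (inj₂ c) ⊎
          (∀ r r′ → P t (inj₁ r) ≡ P t x → P t (inj₁ r′) ≡ P t x → A r c ≡ A r′ c))
      × (∀ r → Near t L (inj₁ r) ⊎
          (∀ c c′ → P t (inj₂ c) ≡ P t x → P t (inj₂ c′) ≡ P t x → A r c ≡ A r c′))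
      × (∀ r₁ r r₂ → P t (inj₁ r₁) ≡ P t x → P t (inj₁ r₂) ≡ P t x →
          toℕ r₁ < toℕ r → toℕ r < toℕ r₂ → Near t L (inj₁ r))
      × (∀ c₁ c c₂ → P t (inj₂ c₁) ≡ P t x → P t (inj₂ c₂) ≡ P t x →
          toℕ c₁ < toℕ c → toℕ c < toℕ c₂ → Near t L (inj₂ c)) )

_ᵀ : ∀ {A : Set} {m n} → Matrix A m n → Matrix A n m
(A ᵀ) c r = A r c

transpose : ∀ {q m n e} {A : Matrix (Fin q) m n} → Sequence A e → Sequence (A ᵀ) e
transpose {q} {m} {n} S = record
  { T = T
  ; P = λ t → P t ∘ S.swap
  ; discrete = λ {x} {y} eq → trans (sym (swap² x)) (trans (cong S.swap (discrete eq)) (swap² y))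
  ; coarsen = λ t<T → coarsen t<T
  ; merge = λ t<T → case merge t<T of λ
      { (a , b , a≢b , ab , inv) → S.swap a , S.swap b ,
          subst₂ (λ u v → P _ u ≢ P _ v) (sym (swap² a)) (sym (swap² b)) a≢b ,
          subst₂ (λ u v → P _ u ≡ P _ v) (sym (swap² a)) (sym (swap² b)) ab ,
          λ x y eq → subst₂ (λ u v → P _ (S.swap x) ≡ P _ (S.swap y) ⊎
              (P _ (S.swap x) ≡ P _ u × P _ (S.swap y) ≡ P _ v) ⊎
              (P _ (S.swap x) ≡ P _ v × P _ (S.swap y) ≡ P _ u))
            (sym (swap² a)) (sym (swap² b)) (inv (S.swap x) (S.swap y) eq) }
  ; total = λ x y → total (S.swap x) (S.swap y)
  ; near = λ t≤T x → case near t≤T (S.swap x) of λ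
      { (L , self , rows , cols , rhull , chull) → S.swap ∘ L ,
          back L _ self ,
          (λ r → S.map₁ (back L _) (cols r)) , (λ c → S.map₁ (back L _) (rows c)) ,
          (λ c₁ c c₂ e₁ e₂ l₁ l₂ → back L _ (chull c₁ c c₂ e₁ e₂ l₁ l₂)) ,
          (λ c₁ c c₂ e₁ e₂ l₁ l₂ → back L _ (rhull c₁ c c₂ e₁ e₂ l₁ l₂)) }
  }
  where
  open Sequence S
  swap² : ∀ {A B : Set} (x : A ⊎ B) → S.swap (S.swap x) ≡ x
  swap² = SP.swap-involutive
  back : ∀ {t k} (L : Fin k → Fin m ⊎ Fin n) y → Near t L y → ∃[ l ] (P t (S.swap (S.swap (L l))) ≡ P t y)
  back L y (l , eq) = l , trans (cong (P _) (swap² (L l))) eq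

entry-row-col : ∀ {A : Set} {m n} (M : Matrix A m n) r c → entry M (r ↑ˡ n) (m ↑ʳ c) ≡ just (M r c)
entry-row-col {m = m} {n} M r c rewrite FP.splitAt-↑ˡ m r n | FP.splitAt-↑ʳ m n c = refl

_≟atp_ : ∀ {q} (s t : AtomicType (Fin q)) → Dec (s ≡ t)
_≟atp_ = PP.≡-dec BP._≟_ (PP.≡-dec BP._≟_ (PP.≡-dec BP._≟_ (PP.≡-dec BP._≟_
  (PP.≡-dec (MP.≡-dec FP._≟_) (MP.≡-dec FP._≟_)))))

module _ {q m n} {A : Matrix (Fin q) m n} where

  atp-entry : ∀ {u v u′ v′} → atp A u v ≡ atp A u′ v′ → entry A u v ≡ entry A u′ v′
  atp-entry = cong λ (_ , _ , _ , _ , a , _) → a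

  atp-entryᵒ : ∀ {u v u′ v′} → atp A u v ≡ atp A u′ v′ → entry A v u ≡ entry A v′ u′
  atp-entryᵒ = cong λ (_ , _ , _ , _ , _ , a) → a

  atp-< : ∀ {u v u′ v′} → atp A u v ≡ atp A u′ v′ → does (u F.<? v) ≡ does (u′ F.<? v′)
  atp-< = cong λ (_ , _ , b , _) → b

  module _ {d d′} (C : ContractionSeq A d) (d≤d′ : d ≤ d′) where
    open ContractionSeq C renaming (P to Q)
    private
      el : Fin m ⊎ Fin n → Fin (m + n)
      el = join m n

    Homogeneous : ℕ → Fin (m + n) → Fin (m + n) → Set
    Homogeneous t x y = ∀ {u u′ v v′} → Q t u ≡ Q t x → Q t u′ ≡ Q t x → Q t v ≡ Q t y → Q t v′ ≡ Q t y →
      atp A u v ≡ atp A u′ v′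

    -- If no listed part is the part of `y`, two pairs with different atomic types would make that
    -- part red-adjacent to the part of `x`. Equality of atomic types is decidable, so the absence
    -- of such pairs gives homogeneity.
    neighbours : ∀ {t} → t < m + n → ∀ x → ∃[ L ] (length L ≤ suc d′ × Any (λ z → Q t z ≡ Q t x) L ×
      (∀ y → Any (λ z → Q t z ≡ Q t y) L ⊎ Homogeneous t x y))
    neighbours {t} t< x with width t t< x
    ... | L , len , covers = x ∷ L , s≤s (≤-trans len d≤d′) , here refl , split
      where
      split : ∀ y → Any (λ z → Q t z ≡ Q t y) (x ∷ L) ⊎ Homogeneous t x y
      split y with any? (λ z → Q t z N.≟ Q t y) (x ∷ L)
      ... | yes p = inj₁ p
      ... | no ¬p = inj₂ λ {u} {u′} {v} {v′} a b c d → decidable-stable (atp A u v ≟atp atp A u′ v′) λ ne →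
        case covers y ((λ eq → ¬p (here eq)) , u , u′ , v , v′ , a , b , c , d , ne) of λ
          { (z , z∈L , eq) → ¬p (there (Any.map (λ { refl → eq }) z∈L)) }

    -- The slack `d ≤ d′` lets the sequences of both factors share one bound; the successor counts
    -- the part itself.
    toSequence : Sequence A (suc d′)
    toSequence = record
      { T = m + n ∸ 1
      ; P = λ t x → Q t (el x)
      ; discrete = λ {x} {y} eq → trans (sym (FP.splitAt-join m n x))
          (trans (cong (splitAt m) (start _ _ eq)) (FP.splitAt-join m n y))
      ; coarsen = λ t<T eq → proj₂ (proj₂ (proj₂ (proj₂ (step _ (1+t<N t<T)))) _ _) (inj₁ eq)
      ; merge = λ t<T → case step _ (1+t<N t<T) of λ
          { (a , b , a≢b , iff) → splitAt m a , splitAt m b ,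
              subst₂ (λ u v → Q _ u ≢ Q _ v) (sym (e-split a)) (sym (e-split b)) a≢b ,
              subst₂ (λ u v → Q _ u ≡ Q _ v) (sym (e-split a)) (sym (e-split b)) (proj₂ (iff a b) (inj₂ (inj₁ (refl , refl)))) ,
              λ x y eq → subst₂ (λ u v → Q _ (el x) ≡ Q _ (el y) ⊎
                  (Q _ (el x) ≡ Q _ u × Q _ (el y) ≡ Q _ v) ⊎ (Q _ (el x) ≡ Q _ v × Q _ (el y) ≡ Q _ u))
                (sym (e-split a)) (sym (e-split b)) (proj₁ (iff (el x) (el y)) eq) }
      ; total = λ x y → finish (el x) (el y)
      ; near = nearby
      }
      where
      e-split : ∀ x → el (splitAt m x) ≡ x
      e-split = FP.join-splitAt m n
      1+t<N : ∀ {t} → t < m + n ∸ 1 → suc t < m + n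
      1+t<N {t} lt with m + n
      ... | suc N = s≤s lt
      t<N : ∀ {t} → t ≤ m + n ∸ 1 → Fin (m + n) → t < m + n
      t<N {t} le x with m + n
      ... | suc N = s≤s le
      nearby : ∀ {t} → t ≤ m + n ∸ 1 → ∀ x → _
      nearby {t} t≤T x with neighbours (t<N t≤T (el x)) (el x)
      ... | Ls , len , self , split with pad (el x) Ls len
      ... | Y , complete = splitAt m ∘ Y , fromAny self ,
          (λ c → S.map fromAny (λ hom r r′ er er′ → MP.just-injective
             (subst₂ _≡_ (entry-row-col A r c) (entry-row-col A r′ c) (atp-entry (hom er er′ refl refl)))) (split (m ↑ʳ c))) ,
          (λ r → S.map fromAny (λ hom c c′ ec ec′ → MP.just-injective
             (subst₂ _≡_ (entry-row-col A r c) (entry-row-col A r c′) (atp-entryᵒ (hom ec ec′ refl refl)))) (split (r ↑ˡ n))) ,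
          (λ r₁ r r₂ e₁ e₂ l₁ l₂ → between e₁ e₂
             (subst₂ _<_ (sym (FP.toℕ-↑ˡ r₁ n)) (sym (FP.toℕ-↑ˡ r n)) l₁)
             (subst₂ _<_ (sym (FP.toℕ-↑ˡ r n)) (sym (FP.toℕ-↑ˡ r₂ n)) l₂)) ,
          (λ c₁ c c₂ e₁ e₂ l₁ l₂ → between e₁ e₂
             (subst₂ _<_ (sym (FP.toℕ-↑ʳ m c₁)) (sym (FP.toℕ-↑ʳ m c)) (+-monoʳ-< m l₁))
             (subst₂ _<_ (sym (FP.toℕ-↑ʳ m c)) (sym (FP.toℕ-↑ʳ m c₂)) (+-monoʳ-< m l₂)))
        where
        fromAny : ∀ {y} → Any (λ z → Q t z ≡ Q t y) Ls → ∃[ k ] (Q t (el (splitAt m (Y k))) ≡ Q t y)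
        fromAny p with find p
        ... | z , z∈Ls , eq with complete z∈Ls
        ... | k , refl = k , trans (cong (Q t) (e-split (Y k))) eq
        between : ∀ {u₁ v u₂} → Q t u₁ ≡ Q t (el x) → Q t u₂ ≡ Q t (el x) → toℕ u₁ < toℕ v → toℕ v < toℕ u₂ →
          ∃[ k ] (Q t (el (splitAt m (Y k))) ≡ Q t v)
        between {u₁} {v} {u₂} e₁ e₂ l₁ l₂ with split v
        ... | inj₁ p = fromAny p
        -- The order belongs to the atomic type: homogeneity would put `u₁` and `u₂` on the same
        -- side of `v`, but `v` lies strictly between them.
        ... | inj₂ hom with trans (sym (dec-true (u₁ F.<? v) l₁))
                (trans (atp-< (hom e₁ e₂ refl refl)) (dec-false (u₂ F.<? v) (<⇒≯ l₂)))
        ... | ()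

-- Exceptional parts

-- `Y` names the removed column labels and `g` the class of a row. Both may be redundant, so `k₁`
-- and `k₂` are upper bounds.
Poor : ∀ {q m n} → ℕ → ℕ → (Fin m → Fin n → Fin q) → (Fin m → ℕ) → (Fin n → ℕ) → ℕ → Set
Poor {m = m} k₁ k₂ A ρ ν i = Σ[ Y ∈ (Fin k₁ → ℕ) ] Σ[ g ∈ (Fin m → Fin k₂) ]
  (∀ x x′ → ρ x ≡ i → ρ x′ ≡ i → g x ≡ g x′ → ∀ c → (∀ l → ν c ≢ Y l) → A x c ≡ A x′ c)

-- The summand 20 makes every part poor as soon as there are at most 20 parts on the other side.
removedParts : ℕ → ℕ → ℕ
removedParts e g = (2 + e) * e * suc g + 20

-- A row of a newly hulled interval is coded by the one among `2 + e` parts that contains it and by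
-- one letter for each of the `e` neighbours of each of these parts.
rowClasses : ℕ → ℕ → ℕ
rowClasses e q = (2 + e) * q ^ ((2 + e) * e)

-- By `branch ≤ plain`, `k` is at most `4 * e * plain`. With `32 * (e * e) ≤ g` the budget yields
-- `8 * k ≤ s` after cancelling `e`, and the two additional labels contribute 16. For `e = 0` there
-- is nothing to cancel, but then `k = 0`.
exceptional-bound : ∀ e g plain branch k s → 32 * (e * e) ≤ g → g * plain ≤ s * e → branch ≤ plain →
  k ≤ (e + e) * (plain + branch) → 8 * (2 + k) ≤ s + 16
exceptional-bound zero    g plain branch k s _ _ _ k≤ with n≤0⇒n≡0 k≤
... | refl = m≤n+m 16 s
exceptional-bound (suc d) g plain branch k s large budget b≤p k≤ =
  ≤-trans (≤-reflexive (distribute k)) (+-monoˡ-≤ 16 (*-cancelʳ-≤ (8 * k) s e scaled))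
  where
  e = suc d
  distribute : ∀ k → 8 * (2 + k) ≡ 8 * k + 16
  distribute = NS.solve-∀
  collect : ∀ e p → 8 * ((e + e) * (p + p)) * e ≡ 32 * (e * e) * p
  collect = NS.solve-∀
  scaled : 8 * k * e ≤ s * e
  scaled = ≤-trans (*-monoˡ-≤ e (*-monoʳ-≤ 8 (≤-trans k≤ (*-monoʳ-≤ (e + e) (+-monoʳ-≤ plain b≤p)))))
    (≤-trans (≤-reflexive (collect e plain)) (≤-trans (*-monoˡ-≤ plain large) budget))

module Exceptional {q m n e} (g : ℕ) (ε : Fin q) {A : Fin m → Fin n → Fin q} (S : Sequence A e)
  {ρ : Fin m → ℕ} (ρ-mono : Monotone ρ) {ν : Fin n → ℕ} (ν-mono : Monotone ν)
  (s : ℕ) (ν<s : ∀ c → ν c < s) where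

  open Sequence S

  E : Set
  E = Fin m ⊎ Fin n

  h : ℕ
  h = suc g

  PoorRow : ℕ → Set
  PoorRow = Poor (removedParts e g) (rowClasses e q) A ρ ν

  -- The strict inequalities place every row of interval `i` between two rows of one part, which is
  -- what the hull clause of `near` asks for.
  Hulled : ℕ → ℕ → Set
  Hulled t i = ∃[ r₁ ] ∃[ r₂ ] (P t (inj₁ r₁) ≡ P t (inj₁ r₂) × ρ r₁ < i × i < ρ r₂)

  hulled? : ∀ t i → Dec (Hulled t i)
  hulled? t i = FP.any? λ r₁ → FP.any? λ r₂ →
    (P t (inj₁ r₁) N.≟ P t (inj₁ r₂)) ×-dec ((ρ r₁ <? i) ×-dec (i <? ρ r₂))

  Touches : ℕ → (Fin n → Bool) → E → ℕ → Set
  Touches t abs x j = ∃[ c ] (P t (inj₂ c) ≡ P t x × abs c ≡ false × ν c ≡ j)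

  touches? : ∀ t abs x j → Dec (Touches t abs x j)
  touches? t abs x j = FP.any? λ c →
    (P t (inj₂ c) N.≟ P t x) ×-dec ((abs c B.≟ false) ×-dec (ν c N.≟ j))

  touched : ℕ → (Fin n → Bool) → E → ℕ
  touched t abs x = sumN s λ j → ind (touches? t abs x j)

  -- A label without a list carries the full credit `e`, the length of a list of neighbours;
  -- afterwards its credit is the length of the list that covers its fresh columns.
  credit : Maybe (List E) → ℕ
  credit nothing  = e
  credit (just w) = length w

  Covers : ℕ → List E → Fin n → Set
  Covers t L c = Any (λ v → P t v ≡ P t (inj₂ c)) L

  -- Merging two parts that both contain absorbed columns, or creating a part whose fresh columns
  -- touch more than h column labels, absorbs all columns of the new part.  The few row labels that
  -- can distinguish the columns absorbed together are recorded in K.  The two kinds of absorption are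
  -- counted by branch and plain; the second is paid for by credits: a column label j that lies inside the hull of some part is met by at most
  -- e parts, and those that still have fresh columns there are covered by W j.
  record State (t : ℕ) : Set where
    field
      abs    : Fin n → Bool
      K      : List ℕ
      plain branch : ℕ
      V      : List E
      W      : ℕ → Maybe (List E)
      hulled   : ∀ i → Hulled t i → i ∈ K ⊎ PoorRow i
      constant : ∀ {i} → ¬ Hulled t i → i ∉ K → ∀ {x} → ρ x ≡ i → ∀ {c c′} → abs c ≡ true → abs c′ ≡ true →
        P t (inj₂ c) ≡ P t (inj₂ c′) → A x c ≡ A x c′
      fresh    : ∀ x → touched t abs x ≤ h
      V-cover  : ∀ c → abs c ≡ true → Covers t V c
      V-length : branch + length V ≤ plain
      W-cover  : ∀ {j w} → W j ≡ just w → ∀ c → abs c ≡ false → ν c ≡ j → Covers t w c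
      budget   : g * plain + sumN s (λ j → credit (W j)) ≤ s * e
      K-length : length K ≤ (e + e) * (plain + branch)

  initial : State 0
  initial = record
    { abs = λ _ → false ; K = [] ; plain = 0 ; branch = 0 ; V = [] ; W = λ _ → nothing
    ; hulled = λ { i (r₁ , r₂ , eq , l₁ , l₂) →
        ⊥-elim (<-irrefl (cong ρ (SP.inj₁-injective (discrete eq))) (<-trans l₁ l₂)) }
    ; constant = λ _ _ _ ()
    ; fresh = λ x → ≤-trans (one x) (s≤s z≤n)
    ; V-cover = λ _ ()
    ; V-length = z≤n
    ; W-cover = λ ()
    ; budget = ≤-reflexive (trans (cong (_+ sumN s (λ _ → e)) (*-zeroʳ g)) (sumN-const s e))
    ; K-length = z≤n
    }
    where
    one : ∀ x → touched 0 (λ _ → false) x ≤ 1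
    one (inj₁ r) = ≤-trans (sumN-mono s (λ j _ → ind-mono (touches? 0 _ (inj₁ r) j) (j N.≟ 0)
      λ { (c , eq , _) → case discrete eq of λ () })) (sumN-≡ s 0)
    one (inj₂ c₀) = ≤-trans (sumN-mono s (λ j _ → ind-mono (touches? 0 _ (inj₂ c₀) j) (j N.≟ ν c₀)
      λ { (c , eq , _ , νc) → trans (sym νc) (cong ν (SP.inj₂-injective (discrete eq))) })) (sumN-≡ s (ν c₀))

  module Step {t} (t<T : t < T) (σ : State t) where
    open State σ

    private
      a b : E
      a = proj₁ (merge t<T)
      b = proj₁ (proj₂ (merge t<T))
      a≢b : P t a ≢ P t b
      a≢b = proj₁ (proj₂ (proj₂ (merge t<T)))
      ab : P (suc t) a ≡ P (suc t) b
      ab = proj₁ (proj₂ (proj₂ (proj₂ (merge t<T))))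
      split : ∀ x y → P (suc t) x ≡ P (suc t) y →
        P t x ≡ P t y ⊎ (P t x ≡ P t a × P t y ≡ P t b) ⊎ (P t x ≡ P t b × P t y ≡ P t a)
      split = proj₂ (proj₂ (proj₂ (proj₂ (merge t<T))))
      up : ∀ {x y} → P t x ≡ P t y → P (suc t) x ≡ P (suc t) y
      up = coarsen t<T

    hulled-up : ∀ {i} → Hulled t i → Hulled (suc t) i
    hulled-up (r₁ , r₂ , eq , l) = r₁ , r₂ , up eq , l

    module NewlyHulled {i} (¬hull : ¬ Hulled t i) (i∉K : i ∉ K) (hull : Hulled (suc t) i) where
      r₁ r₂ : Fin m
      r₁ = proj₁ hull
      r₂ = proj₁ (proj₂ hull)

      L : Fin e → E
      L = proj₁ (near t<T (inj₁ r₁))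

      -- At time `suc t` the neighbours `L` of the part that stretches across `i` cover the
      -- interval. One of them may be the part just created, which at time `t` is still `a` and `b`;
      -- hence the two extra entries.
      U : Fin (2 + e) → E
      U zero          = a
      U (suc zero)    = b
      U (suc (suc k)) = L k

      U-near : ∀ x → ρ x ≡ i → Near t U (inj₁ x)
      U-near x refl with proj₁ (proj₂ (proj₂ (proj₂ (proj₂ (near t<T (inj₁ r₁)))))) r₁ x r₂ refl
        (sym (proj₁ (proj₂ (proj₂ hull))))
        (monotone-reflects-< ρ-mono (proj₁ (proj₂ (proj₂ (proj₂ hull)))))
        (monotone-reflects-< ρ-mono (proj₂ (proj₂ (proj₂ (proj₂ hull)))))
      ... | k , eq with split (L k) (inj₁ x) eq
      ... | inj₁ p = suc (suc k) , p
      ... | inj₂ (inj₁ (_ , p)) = suc zero , sym p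
      ... | inj₂ (inj₂ (_ , p)) = zero , sym p

      LL : Fin (2 + e) → Fin e → E
      LL k = proj₁ (near (<⇒≤ t<T) (U k))

      J : ∀ y → Σ[ Y ∈ (Fin h → ℕ) ] (∀ j → j < s → Touches t abs y j → ∃[ l ] (Y l ≡ j))
      J y with enumerate s (touches? t abs y)
      ... | Ls , len , all with pad 0 Ls (≤-trans (≤-reflexive len) (fresh y))
      ... | Y , complete = Y , λ j j<s p → complete (all j j<s p)

      Y : Σ[ Y ∈ (Fin (removedParts e g) → ℕ) ] (∀ k l j → ∃[ z ] (Y z ≡ proj₁ (J (LL k l)) j))
      Y = flatten (2 + e) e h 20 (λ k l → proj₁ (J (LL k l)))

      class : Fin m → Fin (2 + e)
      class x = [ (λ _ → zero) , proj₁ ]′ (first? λ k → P t (U k) N.≟ P t (inj₁ x))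

      class-near : ∀ x → ρ x ≡ i → P t (U (class x)) ≡ P t (inj₁ x)
      class-near x ρx with first? (λ k → P t (U k) N.≟ P t (inj₁ x))
      ... | inj₁ none = let (k , eq) = U-near x ρx in ⊥-elim (none k eq)
      ... | inj₂ (k , eq , _) = eq

      Absorbed : E → Fin n → Set
      Absorbed y c = abs c ≡ true × P t (inj₂ c) ≡ P t y

      valueAt : ∀ {y} → Fin m → (∀ c → ¬ Absorbed y c) ⊎ ∃[ c ] (Absorbed y c × (∀ c′ → Absorbed y c′ → toℕ c ≤ toℕ c′)) → Fin q
      valueAt x = [ (λ _ → ε) , (λ (c , _) → A x c) ]′

      -- As `i` is neither hulled at time `t` nor in `K`, each row of `i` is constant on the
      -- absorbed columns of a part, so the first such column speaks for all. A part without
      -- absorbed columns gets the default `ε`.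
      value : Fin m → E → Fin q
      value x y = valueAt {y} x (first? λ c → (abs c B.≟ true) ×-dec (P t (inj₂ c) N.≟ P t y))

      value-absorbed : ∀ x → ρ x ≡ i → ∀ y c → Absorbed y c → value x y ≡ A x c
      value-absorbed x ρx y c (ac , pc) = at (first? λ c → (abs c B.≟ true) ×-dec (P t (inj₂ c) N.≟ P t y))
        where
        at : ∀ o → valueAt {y} x o ≡ A x c
        at (inj₁ none) = ⊥-elim (none c (ac , pc))
        at (inj₂ (c₀ , (a₀ , p₀) , _)) = constant ¬hull i∉K ρx a₀ ac (trans p₀ (sym pc))

      table : Fin m → Fin (2 + e) → Fin e → Fin q
      table x k l = value x (LL k l)

      -- Take two rows of one class and a column `c`. If the part of `c` is not near theirs,
      -- homogeneity applies. If it is near and `c` is absorbed, the tables record the entry. If it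
      -- is near and `c` is fresh, the label of `c` is among the at most `h` touched labels of that
      -- neighbour, all of which are removed.
      poor : PoorRow i
      poor = proj₁ Y , (λ x → tableCode {2 + e} {2 + e} {e} (class x) (table x)) , same
        where
        same : ∀ x x′ → ρ x ≡ i → ρ x′ ≡ i →
          tableCode {2 + e} {2 + e} {e} (class x) (table x) ≡ tableCode {2 + e} {2 + e} {e} (class x′) (table x′) →
          ∀ c → (∀ l → ν c ≢ proj₁ Y l) → A x c ≡ A x′ c
        same x x′ ρx ρx′ eq c out = go (proj₁ (proj₂ (proj₂ (near (<⇒≤ t<T) (U (class x))))) c)
          where
          class-eq : class x ≡ class x′
          class-eq = proj₁ (tableCode-injective {2 + e} {2 + e} {e} (class x) (class x′) (table x) (table x′) eq)
          values-eq : ∀ k l → value x (LL k l) ≡ value x′ (LL k l)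
          values-eq = proj₂ (tableCode-injective {2 + e} {2 + e} {e} (class x) (class x′) (table x) (table x′) eq)
          go : Near t (LL (class x)) (inj₂ c) ⊎ (∀ r r′ → P t (inj₁ r) ≡ P t (U (class x)) →
            P t (inj₁ r′) ≡ P t (U (class x)) → A r c ≡ A r′ c) → A x c ≡ A x′ c
          go (inj₂ hom) = hom x x′ (sym (class-near x ρx))
            (trans (sym (class-near x′ ρx′)) (cong (λ k → P t (U k)) (sym class-eq)))
          go (inj₁ (l , pc)) = byStatus (abs c) refl
            where
            byStatus : ∀ v → abs c ≡ v → A x c ≡ A x′ c
            byStatus true ac = trans (sym (value-absorbed x ρx _ c (ac , sym pc)))
              (trans (values-eq (class x) l) (value-absorbed x′ ρx′ _ c (ac , sym pc)))
            byStatus false ac =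
              let (j , eqj) = proj₂ (J (LL (class x) l)) (ν c) (ν<s c) (c , sym pc , ac , refl)
                  (z , eqz) = proj₂ Y (class x) l j
              in ⊥-elim (out z (sym (trans eqz eqj)))

    hulled-next : ∀ i → Hulled (suc t) i → i ∈ K ⊎ PoorRow i
    hulled-next i hull with hulled? t i | DM._∈?_ N._≟_ i K
    ... | yes old | _ = hulled i old
    ... | no _ | yes i∈K = inj₁ i∈K
    ... | no ¬old | no i∉K = inj₂ (NewlyHulled.poor ¬old i∉K hull)

    private
      otherClass : ∀ {x y} → P (suc t) x ≡ P (suc t) y → P (suc t) y ≢ P (suc t) a → P t x ≡ P t y
      otherClass {x} {y} eq y≢a with split x y eq
      ... | inj₁ p = p
      ... | inj₂ (inj₁ (_ , yb)) = ⊥-elim (y≢a (trans (up yb) (sym ab)))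
      ... | inj₂ (inj₂ (_ , ya)) = ⊥-elim (y≢a (up ya))

    HasAbsorbed : E → Set
    HasAbsorbed x = ∃[ c ] (abs c ≡ true × P t (inj₂ c) ≡ P t x)

    hasAbsorbed? : ∀ x → Dec (HasAbsorbed x)
    hasAbsorbed? x = FP.any? λ c → (abs c B.≟ true) ×-dec (P t (inj₂ c) N.≟ P t x)

    -- When at most one of the merged parts has absorbed columns, the absorbed columns of the new
    -- part formed a single old class, so `constant` survives without new charges.
    keep : ¬ (HasAbsorbed a × HasAbsorbed b) → touched (suc t) abs a ≤ h → State (suc t)
    keep ¬both few = record
      { abs = abs ; K = K ; plain = plain ; branch = branch ; V = V ; W = W
      ; hulled = hulled-next
      ; constant = constant′
      ; fresh = fresh′
      ; V-cover = λ c ac → Any.map up (V-cover c ac)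
      ; V-length = V-length
      ; W-cover = λ wj c ac νc → Any.map up (W-cover wj c ac νc)
      ; budget = budget
      ; K-length = K-length
      }
      where
      constant′ : ∀ {i} → ¬ Hulled (suc t) i → i ∉ K → ∀ {x} → ρ x ≡ i → ∀ {c c′} → abs c ≡ true → abs c′ ≡ true →
        P (suc t) (inj₂ c) ≡ P (suc t) (inj₂ c′) → A x c ≡ A x c′
      constant′ ¬hull i∉K ρx {c} {c′} ac ac′ eq with split (inj₂ c) (inj₂ c′) eq
      ... | inj₁ p = constant (¬hull ∘ hulled-up) i∉K ρx ac ac′ p
      ... | inj₂ (inj₁ (ca , cb)) = ⊥-elim (¬both ((c , ac , ca) , (c′ , ac′ , cb)))
      ... | inj₂ (inj₂ (cb , ca)) = ⊥-elim (¬both ((c′ , ac′ , ca) , (c , ac , cb)))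
      fresh′ : ∀ x → touched (suc t) abs x ≤ h
      fresh′ x with P (suc t) x N.≟ P (suc t) a
      ... | yes xa = ≤-trans (sumN-mono s λ j _ → ind-mono (touches? (suc t) abs x j) (touches? (suc t) abs a j)
              λ (c , cx , rest) → c , trans cx xa , rest) few
      ... | no x≢a = ≤-trans (sumN-mono s λ j _ → ind-mono (touches? (suc t) abs x j) (touches? t abs x j)
              λ (c , cx , rest) → c , otherClass cx x≢a , rest) (fresh x)

    module Mark where
      status : ∀ {X : Set} → Dec X → Bool → Bool
      status (yes _) _ = true
      status (no _)  v = v

      abs′ : Fin n → Bool
      abs′ c = status (P (suc t) (inj₂ c) N.≟ P (suc t) a) (abs c)

      absorbed′ : ∀ c → abs′ c ≡ true → P (suc t) (inj₂ c) ≡ P (suc t) a ⊎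
        (P (suc t) (inj₂ c) ≢ P (suc t) a × abs c ≡ true)
      absorbed′ c = go (P (suc t) (inj₂ c) N.≟ P (suc t) a)
        where
        go : ∀ d → status d (abs c) ≡ true → P (suc t) (inj₂ c) ≡ P (suc t) a ⊎
          (P (suc t) (inj₂ c) ≢ P (suc t) a × abs c ≡ true)
        go (yes p) _ = inj₁ p
        go (no ¬p) v = inj₂ (¬p , v)

      fresh-status : ∀ c → abs′ c ≡ false → P (suc t) (inj₂ c) ≢ P (suc t) a × abs c ≡ false
      fresh-status c = go (P (suc t) (inj₂ c) N.≟ P (suc t) a)
        where
        go : ∀ d → status d (abs c) ≡ false → P (suc t) (inj₂ c) ≢ P (suc t) a × abs c ≡ false
        go (no ¬p) v = ¬p , v

      L : Fin e → E
      L = proj₁ (near t<T a)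

      firstLabel lastLabel : E → ℕ
      firstLabel z = [ (λ _ → 0) , (λ (r , _) → ρ r) ]′ (first? λ r → P (suc t) (inj₁ r) N.≟ P (suc t) z)
      lastLabel  z = [ (λ _ → 0) , (λ (r , _) → ρ r) ]′ (last? λ r → P (suc t) (inj₁ r) N.≟ P (suc t) z)

      firstLabel-≤ : ∀ z r → P (suc t) (inj₁ r) ≡ P (suc t) z →
        ∃[ r₀ ] (firstLabel z ≡ ρ r₀ × P (suc t) (inj₁ r₀) ≡ P (suc t) z × ρ r₀ ≤ ρ r)
      firstLabel-≤ z r eq with first? (λ r → P (suc t) (inj₁ r) N.≟ P (suc t) z)
      ... | inj₁ none = ⊥-elim (none r eq)
      ... | inj₂ (r₀ , p , least) = r₀ , refl , p , ρ-mono (least r eq)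

      lastLabel-≥ : ∀ z r → P (suc t) (inj₁ r) ≡ P (suc t) z →
        ∃[ r₀ ] (lastLabel z ≡ ρ r₀ × P (suc t) (inj₁ r₀) ≡ P (suc t) z × ρ r ≤ ρ r₀)
      lastLabel-≥ z r eq with last? (λ r → P (suc t) (inj₁ r) N.≟ P (suc t) z)
      ... | inj₁ none = ⊥-elim (none r eq)
      ... | inj₂ (r₀ , p , greatest) = r₀ , refl , p , ρ-mono (greatest r eq)

      -- A label strictly between the first and the last label of a part is hulled by that part.
      -- Hence a part meets at most two labels that are not hulled.
      extremal : ∀ z r → P (suc t) (inj₁ r) ≡ P (suc t) z → ¬ Hulled (suc t) (ρ r) →
        ρ r ≡ firstLabel z ⊎ ρ r ≡ lastLabel z
      extremal z r eq ¬hull with firstLabel-≤ z r eq | lastLabel-≥ z r eq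
      ... | r₁ , f₁ , e₁ , l₁ | r₂ , f₂ , e₂ , l₂ with m≤n⇒m<n∨m≡n l₁ | m≤n⇒m<n∨m≡n l₂
      ... | inj₂ q | _ = inj₁ (trans (sym q) (sym f₁))
      ... | inj₁ _ | inj₂ q = inj₂ (trans q (sym f₂))
      ... | inj₁ lt₁ | inj₁ lt₂ = ⊥-elim (¬hull (r₁ , r₂ , trans e₁ (sym e₂) , lt₁ , lt₂))

      -- A row that distinguishes two columns of the new part lies in one of its `e` neighbours. If
      -- its label is not hulled, it is an end label of that neighbour, so `e + e` labels suffice.
      charged : List ℕ
      charged = tabulate (firstLabel ∘ L) ++ tabulate (lastLabel ∘ L)

      charged-length : length charged ≡ e + e
      charged-length = trans (LP.length-++ (tabulate (firstLabel ∘ L)))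
        (cong₂ _+_ (LP.length-tabulate (firstLabel ∘ L)) (LP.length-tabulate (lastLabel ∘ L)))

      near-charged : ∀ r → Near (suc t) L (inj₁ r) → ¬ Hulled (suc t) (ρ r) → ρ r ∈ charged
      near-charged r (k , eq) ¬hull with extremal (L k) r (sym eq) ¬hull
      ... | inj₁ p = ∈-++⁺ˡ (subst (_∈ tabulate (firstLabel ∘ L)) (sym p) (∈-tabulate⁺ k))
      ... | inj₂ p = ∈-++⁺ʳ (tabulate (firstLabel ∘ L)) (subst (_∈ tabulate (lastLabel ∘ L)) (sym p) (∈-tabulate⁺ k))

      K′ : List ℕ
      K′ = charged ++ K

      K′-length : length K′ ≤ (e + e) * suc (plain + branch)
      K′-length = ≤-trans (≤-reflexive (trans (LP.length-++ charged) (cong (_+ length K) charged-length)))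
        (≤-trans (+-monoʳ-≤ (e + e) K-length) (≤-reflexive (sym (*-suc (e + e) (plain + branch)))))

      hulled′ : ∀ i → Hulled (suc t) i → i ∈ K′ ⊎ PoorRow i
      hulled′ i hull = S.map₁ (∈-++⁺ʳ charged) (hulled-next i hull)

      constant′ : ∀ {i} → ¬ Hulled (suc t) i → i ∉ K′ → ∀ {x} → ρ x ≡ i → ∀ {c c′} → abs′ c ≡ true → abs′ c′ ≡ true →
        P (suc t) (inj₂ c) ≡ P (suc t) (inj₂ c′) → A x c ≡ A x c′
      constant′ ¬hull i∉K′ {x} refl {c} {c′} ac ac′ eq with absorbed′ c ac | absorbed′ c′ ac′
      ... | inj₁ ca | _ = [ (λ nr → ⊥-elim (i∉K′ (∈-++⁺ˡ (near-charged x nr ¬hull))))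
                          , (λ hom → hom c c′ ca (trans (sym eq) ca)) ]′ (proj₁ (proj₂ (proj₂ (proj₂ (near t<T a)))) x)
      ... | inj₂ (c≢a , _) | inj₁ ca′ = ⊥-elim (c≢a (trans eq ca′))
      ... | inj₂ (_ , old) | inj₂ (c′≢a , old′) =
        constant (¬hull ∘ hulled-up) (i∉K′ ∘ ∈-++⁺ʳ charged) refl old old′ (otherClass eq c′≢a)

      fresh′ : ∀ x → touched (suc t) abs′ x ≤ h
      fresh′ x = ≤-trans (sumN-mono s λ j _ → ind-mono (touches? (suc t) abs′ x j) (touches? t abs x j)
        λ (c , cx , fc , νc) → c , otherClass cx (λ xa → proj₁ (fresh-status c fc) (trans cx xa)) ,
          proj₂ (fresh-status c fc) , νc) (fresh x)

      -- `V` has an entry in the part of `a` and one in the part of `b`. After the merge the former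
      -- represents both, so dropping the latter shortens `V` and pays for the increase of `branch`.
      branching : HasAbsorbed a → HasAbsorbed b → State (suc t)
      branching (c₁ , ac₁ , ca₁) (c₂ , ac₂ , cb₂) = record
        { abs = abs′ ; K = K′ ; plain = plain ; branch = suc branch ; V = V′ ; W = W
        ; hulled = hulled′ ; constant = constant′ ; fresh = fresh′
        ; V-cover = V′-cover
        ; V-length = ≤-trans (≤-reflexive (sym (+-suc branch (length V′)))) (≤-trans (+-monoʳ-≤ branch shorter) V-length)
        ; W-cover = λ wj c fc νc → Any.map up (W-cover wj c (proj₂ (fresh-status c fc)) νc)
        ; budget = budget
        ; K-length = subst (λ k → length K′ ≤ (e + e) * k) (sym (+-suc plain branch)) K′-length
        }
        where
        notB? : ∀ v → Dec (P t v ≢ P t b)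
        notB? v = ¬? (P t v N.≟ P t b)
        V′ : List E
        V′ = filter notB? V
        shorter : length V′ < length V
        shorter = LP.filter-notAll notB? V (Any.map (λ eq ¬b → ¬b (trans eq cb₂)) (V-cover c₂ ac₂))
        V′-cover : ∀ c → abs′ c ≡ true → Covers (suc t) V′ c
        V′-cover c ac with absorbed′ c ac
        ... | inj₁ ca = let (v , v∈V , eq) = find (V-cover c₁ ac₁) in
              lose (∈-filter⁺ notB? v∈V λ vb → a≢b (trans (sym (trans eq ca₁)) vb)) (trans (up (trans eq ca₁)) (sym ca))
        ... | inj₂ (c≢a , old) = let (v , v∈V , eq) = find (V-cover c old) in
              lose (∈-filter⁺ notB? v∈V λ vb → c≢a (trans (up (trans (sym eq) vb)) (sym ab))) (up eq)

      Interior : ℕ → Set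
      Interior j = Touches (suc t) abs a j × ∃[ c₁ ] ∃[ c₂ ]
        (P (suc t) (inj₂ c₁) ≡ P (suc t) a × P (suc t) (inj₂ c₂) ≡ P (suc t) a × ν c₁ < j × j < ν c₂)

      interior? : ∀ j → Dec (Interior j)
      interior? j = touches? (suc t) abs a j ×-dec (FP.any? λ c₁ → FP.any? λ c₂ →
        (P (suc t) (inj₂ c₁) N.≟ P (suc t) a) ×-dec ((P (suc t) (inj₂ c₂) N.≟ P (suc t) a) ×-dec
        ((ν c₁ <? j) ×-dec (j <? ν c₂))))

      -- More than `h = suc g` touched labels means at least `g + 2`; only the labels of the first
      -- and of the last column of the part can fail to be interior.
      many-interior : h < touched (suc t) abs a → g ≤ sumN s (λ j → ind (interior? j))
      many-interior many with first? (λ c → P (suc t) (inj₂ c) N.≟ P (suc t) a) | last? (λ c → P (suc t) (inj₂ c) N.≟ P (suc t) a)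
      ... | inj₁ none | _ = ⊥-elim (<⇒≱ many (≤-trans (sumN-mono s λ j _ → ind-mono (touches? (suc t) abs a j) (j N.≟ 0)
              λ (c , ca , _) → ⊥-elim (none c ca)) (≤-trans (sumN-≡ s 0) (s≤s z≤n))))
      ... | inj₂ _ | inj₁ none = ⊥-elim (<⇒≱ many (≤-trans (sumN-mono s λ j _ → ind-mono (touches? (suc t) abs a j) (j N.≟ 0)
              λ (c , ca , _) → ⊥-elim (none c ca)) (≤-trans (sumN-≡ s 0) (s≤s z≤n))))
      ... | inj₂ (c₁ , p₁ , least) | inj₂ (c₂ , p₂ , greatest) =
        +-cancelʳ-≤ 2 g _ (≤-trans (≤-reflexive (+-comm g 2)) (≤-trans many (≤-trans total-≤ (+-monoʳ-≤ _ (+-mono-≤ (sumN-≡ s (ν c₁)) (sumN-≡ s (ν c₂)))))))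
        where
        pointwise : ∀ j → ind (touches? (suc t) abs a j) ≤ ind (interior? j) + (ind (j N.≟ ν c₁) + ind (j N.≟ ν c₂))
        pointwise j with touches? (suc t) abs a j | interior? j | j N.≟ ν c₁ | j N.≟ ν c₂
        ... | no _  | _     | _     | _     = z≤n
        ... | yes _ | yes _ | _     | _     = s≤s z≤n
        ... | yes _ | no _  | yes _ | _     = s≤s z≤n
        ... | yes _ | no _  | no _  | yes _ = s≤s z≤n
        ... | yes (c , ca , fc , refl) | no ¬int | no j≢₁ | no j≢₂ =
          ⊥-elim (¬int ((c , ca , fc , refl) , c₁ , c₂ , p₁ , p₂ ,
            ≤∧≢⇒< (ν-mono (least c ca)) (j≢₁ ∘ sym) , ≤∧≢⇒< (ν-mono (greatest c ca)) j≢₂))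
        total-≤ : touched (suc t) abs a ≤ sumN s (λ j → ind (interior? j)) +
          (sumN s (λ j → ind (j N.≟ ν c₁)) + sumN s (λ j → ind (j N.≟ ν c₂)))
        total-≤ = ≤-trans (sumN-mono s λ j _ → pointwise j) (≤-reflexive
          (trans (sumN-+ s (λ j → ind (interior? j)) _) (cong (sumN s (λ j → ind (interior? j)) +_) (sumN-+ s _ _))))

      notA? : ∀ v → Dec (P (suc t) v ≢ P (suc t) a)
      notA? v = ¬? (P (suc t) v N.≟ P (suc t) a)

      cover : Maybe (List E) → List E
      cover nothing  = tabulate L
      cover (just w) = w

      cover-length : ∀ w → length (cover w) ≡ credit w
      cover-length nothing  = LP.length-tabulate L
      cover-length (just w) = refl

      -- If `j` has no list yet, every column labelled `j` lies strictly between two columns of the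
      -- new part, so the hull clause puts it into one of the neighbours `L`.
      cover-covers : ∀ j → Interior j → ∀ w → W j ≡ w → ∀ c → abs c ≡ false → ν c ≡ j → Covers (suc t) (cover w) c
      cover-covers j _ (just w) wj c fc νc = Any.map up (W-cover wj c fc νc)
      cover-covers j (_ , c₁ , c₂ , p₁ , p₂ , l₁ , l₂) nothing wj c fc refl
        with proj₂ (proj₂ (proj₂ (proj₂ (proj₂ (near t<T a))))) c₁ c c₂ p₁ p₂ (monotone-reflects-< ν-mono l₁) (monotone-reflects-< ν-mono l₂)
      ... | k , eq = lose (∈-tabulate⁺ k) eq

      reduce : ∀ j → Dec (Interior j) → Maybe (List E)
      reduce j (yes _) = just (filter notA? (cover (W j)))
      reduce j (no _)  = W j

      reduce-cover : ∀ j d {w} → reduce j d ≡ just w → ∀ c → abs′ c ≡ false → ν c ≡ j → Covers (suc t) w c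
      reduce-cover j (no _) eq c fc νc = Any.map up (W-cover eq c (proj₂ (fresh-status c fc)) νc)
      reduce-cover j (yes int) refl c fc νc =
        let (v , v∈ , eq) = find (cover-covers j int (W j) refl c (proj₂ (fresh-status c fc)) νc)
        in lose (∈-filter⁺ notA? v∈ λ va → proj₁ (fresh-status c fc) (trans (sym eq) va)) eq

      -- The new part has a fresh column at an interior label, so the covering list contains an
      -- entry of that part. Absorption makes this entry disposable, and the credit falls by at
      -- least one.
      reduce-credit : ∀ j d → credit (reduce j d) + ind d ≤ credit (W j)
      reduce-credit j (no _) = ≤-reflexive (+-identityʳ _)
      reduce-credit j (yes int@((c , ca , fc , νc) , _)) = subst₂ _≤_ (+-comm 1 _) (cover-length (W j))
        (LP.filter-notAll notA? (cover (W j)) (Any.map (λ eq ¬a → ¬a (trans eq ca)) (cover-covers j int (W j) refl c fc νc)))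

      -- At least `g` interior labels lose a credit each, which pays for the new term `g` in the
      -- budget. The new part joins `V`, and `plain` grows along with it.
      plainly : h < touched (suc t) abs a → State (suc t)
      plainly many = record
        { abs = abs′ ; K = K′ ; plain = suc plain ; branch = branch ; V = a ∷ V ; W = λ j → reduce j (interior? j)
        ; hulled = hulled′ ; constant = constant′ ; fresh = fresh′
        ; V-cover = V′-cover
        ; V-length = ≤-trans (≤-reflexive (+-suc branch (length V))) (s≤s V-length)
        ; W-cover = λ {j} → reduce-cover j (interior? j)
        ; budget = budget′
        ; K-length = K′-length
        }
        where
        V′-cover : ∀ c → abs′ c ≡ true → Covers (suc t) (a ∷ V) c
        V′-cover c ac with absorbed′ c ac
        ... | inj₁ ca = here (sym ca)
        ... | inj₂ (_ , old) = there (Any.map up (V-cover c old))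
        credits : sumN s (λ j → credit (reduce j (interior? j))) + g ≤ sumN s (λ j → credit (W j))
        credits = ≤-trans (+-monoʳ-≤ _ (many-interior many)) (≤-trans (≤-reflexive (sym (sumN-+ s _ _)))
          (sumN-mono s λ j _ → reduce-credit j (interior? j)))
        rearrange : ∀ x y z → (x + y) + z ≡ y + (z + x)
        rearrange = NS.solve-∀
        budget′ : g * suc plain + sumN s (λ j → credit (reduce j (interior? j))) ≤ s * e
        budget′ = ≤-trans (≤-reflexive (trans (cong (_+ sumN s (λ j → credit (reduce j (interior? j)))) (*-suc g plain)) (rearrange g _ _)))
          (≤-trans (+-monoʳ-≤ (g * plain) credits) budget)

    next : State (suc t)
    next with hasAbsorbed? a ×-dec hasAbsorbed? b | touched (suc t) abs a ≤? h
    ... | yes (aa , bb) | _ = Mark.branching aa bb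
    ... | no ¬both | yes few = keep ¬both few
    ... | no _ | no ¬few = Mark.plainly (≰⇒> ¬few)

  run : ∀ t → t ≤ T → State t
  run zero    _   = initial
  run (suc t) t<T = Step.next t<T (run t (<⇒≤ t<T))

  -- A label that is not poor is charged, or is the first or the last label that occurs.
  exceptional : (32 * (e * e)) ≤ g → ∃[ K ] (8 * length K ≤ s + 16 × (∀ i → i ∈ K ⊎ PoorRow i))
  exceptional large = lo ∷ hi ∷ K , bound , decide
    where
    open State (run T ≤-refl)
    lo hi : ℕ
    lo = [ (λ _ → 0) , (λ (r , _) → ρ r) ]′ (first? {P = λ (_ : Fin m) → ⊤} λ _ → yes tt)
    hi = [ (λ _ → 0) , (λ (r , _) → ρ r) ]′ (last? {P = λ (_ : Fin m) → ⊤} λ _ → yes tt)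
    lo-least : ∀ x → ∃[ r ] (lo ≡ ρ r × ρ r ≤ ρ x)
    lo-least x with first? {P = λ (_ : Fin m) → ⊤} (λ _ → yes tt)
    ... | inj₁ none = ⊥-elim (none x tt)
    ... | inj₂ (r , _ , least) = r , refl , ρ-mono (least x tt)
    hi-greatest : ∀ x → ∃[ r ] (hi ≡ ρ r × ρ x ≤ ρ r)
    hi-greatest x with last? {P = λ (_ : Fin m) → ⊤} (λ _ → yes tt)
    ... | inj₁ none = ⊥-elim (none x tt)
    ... | inj₂ (r , _ , greatest) = r , refl , ρ-mono (greatest x tt)
    finish : ∀ x → ρ x ∈ lo ∷ hi ∷ K ⊎ PoorRow (ρ x)
    finish x with lo-least x | hi-greatest x
    ... | r₁ , e₁ , l₁ | r₂ , e₂ , l₂ with m≤n⇒m<n∨m≡n l₁ | m≤n⇒m<n∨m≡n l₂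
    ... | inj₂ q | _ = inj₁ (here (trans (sym q) (sym e₁)))
    ... | inj₁ _ | inj₂ q = inj₁ (there (here (trans q (sym e₂))))
    -- At time `T` a single part remains, and it stretches across every label strictly between the
    -- extreme ones.
    ... | inj₁ lt₁ | inj₁ lt₂ = S.map₁ (there ∘ there) (hulled (ρ x) (r₁ , r₂ , total _ _ , lt₁ , lt₂))
    decide : ∀ i → i ∈ lo ∷ hi ∷ K ⊎ PoorRow i
    decide i with FP.any? (λ x → ρ x N.≟ i)
    ... | yes (x , refl) = finish x
    ... | no none = inj₂ ((λ _ → 0) , (λ _ → tableCode {2 + e} {2 + e} {e} zero (λ _ _ → ε)) , λ x _ ρx → ⊥-elim (none (x , ρx)))
    bound : 8 * (2 + length K) ≤ s + 16
    bound = exceptional-bound e g plain branch (length K) s large (m+n≤o⇒m≤o (g * plain) budget)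
      (m+n≤o⇒m≤o branch V-length) K-length

-- Merging consecutive parts

collapse : ℕ → ℕ → ℕ
collapse p x with x ≤? p
... | yes _ = x
... | no _  = pred x

collapse-inv : ∀ p x → (collapse p x ≡ x × x ≤ p) ⊎ (suc (collapse p x) ≡ x × p ≤ collapse p x)
collapse-inv p x with x ≤? p
... | yes x≤p = inj₁ (refl , x≤p)
collapse-inv p zero    | no ¬le = ⊥-elim (¬le z≤n)
collapse-inv p (suc x) | no ¬le = inj₂ (refl , ≤-pred (≰⇒> ¬le))

collapse-mono : ∀ p {x y} → x ≤ y → collapse p x ≤ collapse p y
collapse-mono p {x} {y} x≤y with x ≤? p | y ≤? p
... | yes _   | yes _   = x≤y
... | yes x≤p | no y≰p  = ≤-trans x≤p (≤-pred-≰ y y≰p)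
  where
  ≤-pred-≰ : ∀ y → ¬ y ≤ p → p ≤ pred y
  ≤-pred-≰ y y≰p = pred-mono-≤ (≰⇒> y≰p)
... | no x≰p  | yes y≤p = ⊥-elim (x≰p (≤-trans x≤y y≤p))
... | no _    | no _    = pred-mono-≤ x≤y

collapse-< : ∀ p r {x} → p < r → x < suc r → collapse p x < r
collapse-< p r {x} p<r x<1+r with collapse-inv p x
... | inj₁ (eq , x≤p) = subst (_< r) (sym eq) (≤-<-trans x≤p p<r)
... | inj₂ (eq , _) = ≤-pred (subst (_< suc r) (sym eq) x<1+r)

module _ {q m n} {k₁ k₂ : ℕ} {A : Fin m → Fin n → Fin q} where

  poor-cong : ∀ {B : Fin m → Fin n → Fin q} → (∀ x c → A x c ≡ B x c) → ∀ {ρ ν i} → Poor k₁ k₂ A ρ ν i → Poor k₁ k₂ B ρ ν i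
  poor-cong A≗B (Y , g , same) = Y , g , λ x x′ ρx ρx′ gx c out →
    trans (sym (A≗B x c)) (trans (same x x′ ρx ρx′ gx c out) (A≗B x′ c))

  poor-coarsen : ∀ {ρ ν i} (f : ℕ → ℕ) → Poor k₁ k₂ A ρ ν i → Poor k₁ k₂ A ρ (f ∘ ν) i
  poor-coarsen f (Y , g , same) = f ∘ Y , g , λ x x′ ρx ρx′ gx c out →
    same x x′ ρx ρx′ gx c λ l eq → out l (cong f eq)

  poor-relabel : ∀ {ρ ρ′ : Fin m → ℕ} {ν i i′} → (∀ x → ρ′ x ≡ i′ → ρ x ≡ i) → Poor k₁ k₂ A ρ ν i → Poor k₁ k₂ A ρ′ ν i′
  poor-relabel back (Y , g , same) = Y , g , λ x x′ ρx ρx′ → same x x′ (back x ρx) (back x′ ρx′)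

  poor-collapse : ∀ {ρ ν} p → (∀ i → Poor k₁ k₂ A ρ ν i) → Poor k₁ k₂ A (collapse p ∘ ρ) ν p →
    ∀ i → Poor k₁ k₂ A (collapse p ∘ ρ) ν i
  poor-collapse {ρ} p poor merged i with i N.≟ p
  ... | yes refl = merged
  ... | no i≢p with i ≤? p
  ... | yes i≤p = poor-relabel below (poor i)
    where
    below : ∀ x → collapse p (ρ x) ≡ i → ρ x ≡ i
    below x eq with collapse-inv p (ρ x)
    ... | inj₁ (id , _) = trans (sym id) eq
    ... | inj₂ (_ , p≤) = ⊥-elim (i≢p (≤-antisym i≤p (subst (p ≤_) eq p≤)))
  ... | no i≰p = poor-relabel above (poor (suc i))
    where
    above : ∀ x → collapse p (ρ x) ≡ i → ρ x ≡ suc i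
    above x eq with collapse-inv p (ρ x)
    ... | inj₁ (id , le) = ⊥-elim (i≰p (subst (_≤ p) (trans (sym id) eq) le))
    ... | inj₂ (id , _) = trans (sym id) (cong suc eq)

  -- Exceptional labels are counted for the halved labelling, whose interval `i` is the union of the
  -- intervals `i + i` and `suc (i + i)`. Collapsing at `i + i` creates the same set of rows.
  poor-pair : ∀ {ρ ν i} → Poor k₁ k₂ A (⌊_/2⌋ ∘ ρ) ν i → Poor k₁ k₂ A (collapse (i + i) ∘ ρ) ν (i + i)
  poor-pair {ρ} {ν} {i} = poor-relabel half
    where
    half-suc : ∀ i → ⌊ suc (i + i) /2⌋ ≡ i
    half-suc zero = refl
    half-suc (suc i) = trans (cong (λ k → ⌊ suc (suc k) /2⌋) (+-suc i i)) (cong suc (half-suc i))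
    half : ∀ x → collapse (i + i) (ρ x) ≡ i + i → ⌊ ρ x /2⌋ ≡ i
    half x eq with collapse-inv (i + i) (ρ x)
    ... | inj₁ (id , _) = trans (cong ⌊_/2⌋ (trans (sym id) eq)) (sym (n≡⌊n+n/2⌋ i))
    ... | inj₂ (id , _) = trans (cong ⌊_/2⌋ (trans (sym id) (cong suc eq))) (half-suc i)

-- With at most `b` labels on the other side, all of them can be removed; the first `k` slots bring
-- the count to the form of `removedParts`.
poor-few : ∀ {q m n} k b {k₂} (A : Fin m → Fin n → Fin q) → Fin k₂ → ∀ {ρ ν i} → (∀ c → ν c < b) → Poor (k + b) k₂ A ρ ν i
poor-few k b A ε ν<b = [ (λ _ → 0) , toℕ ]′ ∘ splitAt k , (λ _ → ε) , λ x x′ _ _ _ c out →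
  ⊥-elim (out (k ↑ʳ fromℕ< (ν<b c)) (sym (trans (cong [ _ , toℕ ]′ (FP.splitAt-↑ʳ k b (fromℕ< (ν<b c)))) (FP.toℕ-fromℕ< (ν<b c)))))

poor-singleton : ∀ {q m n k₁ k₂} (A : Fin m → Fin n → Fin q) → Fin k₂ → ∀ {ν i} → Poor k₁ k₂ A toℕ ν i
poor-singleton A ε = (λ _ → 0) , (λ _ → ε) , λ x x′ ρx ρx′ _ c _ → cong (λ y → A y c) (FP.toℕ-injective (trans ρx (sym ρx′)))

occurrences : ∀ k (K : List ℕ) → sumN k (λ j → ind (DM._∈?_ N._≟_ j K)) ≤ length K
occurrences k [] = ≤-reflexive (trans (sumN-const k 0) (*-zeroʳ k))
occurrences k (x ∷ K) = ≤-trans (sumN-mono k λ j _ → pointwise j)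
  (≤-trans (≤-reflexive (sumN-+ k _ _)) (+-mono-≤ (sumN-≡ k x) (occurrences k K)))
  where
  pointwise : ∀ j → ind (DM._∈?_ N._≟_ j (x ∷ K)) ≤ ind (j N.≟ x) + ind (DM._∈?_ N._≟_ j K)
  pointwise j = ind-⊎ _ (j N.≟ x) (DM._∈?_ N._≟_ j K) λ { (here eq) → inj₁ eq ; (there j∈K) → inj₂ j∈K }

avoid : ∀ k (K : List ℕ) → length K < k → ∃[ i ] (i < k × i ∉ K)
avoid k K len with FP.any? {n = k} (λ j → ¬? (DM._∈?_ N._≟_ (toℕ j) K))
... | yes (j , j∉K) = toℕ j , FP.toℕ<n j , j∉K
... | no none = ⊥-elim (<⇒≱ len (≤-trans (≤-reflexive (sym (trans (sumN-const k 1) (*-identityʳ k))))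
  (≤-trans (sumN-mono k all) (occurrences k K))))
  where
  all : ∀ j → j < k → 1 ≤ ind (DM._∈?_ N._≟_ j K)
  all j j<k with DM._∈?_ N._≟_ j K
  ... | yes _ = ≤-refl
  ... | no j∉K = ⊥-elim (none (fromℕ< j<k , subst (_∉ K) (sym (FP.toℕ-fromℕ< j<k)) j∉K))

pair-< : ∀ i r → i < ⌊ suc r /2⌋ → i + i < r
pair-< zero    (suc r)             _        = s≤s z≤n
pair-< (suc i) (suc (suc r)) (s≤s lt) = s≤s (subst (λ k → suc k ≤ suc r) (sym (+-suc i i)) (s≤s (pair-< i r lt)))
pair-< (suc i) (suc zero)    (s≤s ())

halves : ∀ n → n ≤ suc (⌊ n /2⌋ + ⌊ n /2⌋)
halves zero = z≤n
halves (suc zero) = s≤s z≤n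
halves (suc (suc n)) = s≤s (s≤s (subst (n ≤_) (sym (+-suc ⌊ n /2⌋ ⌊ n /2⌋)) (halves n)))

-- `h ≤ k` would give `4 * r ≤ 8 * h + 4 ≤ 2 * r + 36`, hence `r ≤ 18`, which the threshold 20
-- excludes.
few-exceptions : ∀ r h k → r ≤ suc (h + h) → 20 ≤ r → 8 * k ≤ (r + r) + 32 → k < h
few-exceptions r h k r≤ big k≤ = ≰⇒> λ h≤k → ≤⇒≤ᵇ (≤-trans (+-mono-≤ big big) (+-cancelˡ-≤ (r + r) (r + r) 36 (bound h≤k)))
  where
  open ≤-Reasoning
  bound : h ≤ k → (r + r) + (r + r) ≤ (r + r) + 36
  bound h≤k = begin
    (r + r) + (r + r)       ≡⟨ four r ⟨
    4 * r                   ≤⟨ *-monoʳ-≤ 4 r≤ ⟩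
    4 * suc (h + h)         ≡⟨ eight h ⟩
    8 * h + 4               ≤⟨ +-monoˡ-≤ 4 (≤-trans (*-monoʳ-≤ 8 h≤k) k≤) ⟩
    (r + r) + 32 + 4        ≡⟨ +-assoc (r + r) 32 4 ⟩
    (r + r) + 36            ∎
    where
    four : ∀ x → 4 * x ≡ (x + x) + (x + x)
    four = NS.solve-∀
    eight : ∀ x → 4 * suc (x + x) ≡ 8 * x + 4
    eight = NS.solve-∀

avoid-pair : ∀ r (K : List ℕ) → 20 ≤ suc r → 8 * length K ≤ (suc r + suc r) + 32 → ∃[ i ] (i + i < r × i ∉ K)
avoid-pair r K big len =
  let (i , i< , i∉K) = avoid ⌊ suc r /2⌋ K (few-exceptions (suc r) ⌊ suc r /2⌋ (length K) (halves (suc r)) big len)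
  in i , pair-< i r i< , i∉K

record Division {q m p} (k₁ k₂ : ℕ) (M : Fin m → Fin p → Fin q) (ρ : Fin m → ℕ) (γ : Fin p → ℕ) : Set where
  field
    ρ-mono : Monotone ρ
    γ-mono : Monotone γ
    rows   : ∀ i → Poor k₁ k₂ M ρ γ i
    cols   : ∀ j → Poor k₁ k₂ (M ᵀ) γ ρ j

-- Every stage keeps its `Division`: for partitions between two stages, the finer one supplies
-- representatives and the coarser one limits red neighbours.
data Divisions {q m p} (k₁ k₂ : ℕ) (M : Fin m → Fin p → Fin q) (ρ : Fin m → ℕ) (γ : Fin p → ℕ) : Set where
  stop      : Division k₁ k₂ M ρ γ → (∀ x → ρ x ≡ 0) → (∀ y → γ y ≡ 0) → Divisions k₁ k₂ M ρ γ
  mergeRows : Division k₁ k₂ M ρ γ → ∀ i → Divisions k₁ k₂ M (collapse i ∘ ρ) γ → Divisions k₁ k₂ M ρ γ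
  mergeCols : Division k₁ k₂ M ρ γ → ∀ j → Divisions k₁ k₂ M ρ (collapse j ∘ γ) → Divisions k₁ k₂ M ρ γ

-- Products over a finite field

-- For each of the `k₁` inner labels removed for `A`, the `k₁` column labels removed for that
-- interval of `B`. The factor 1 and the summand 0 match the shape of `flatten`.
productRemoved : ℕ → ℕ
productRemoved k₁ = k₁ * k₁ * 1 + 0

productClasses : ℕ → ℕ → ℕ → ℕ
productClasses q k₁ k₂ = k₂ * q ^ (k₁ * k₂)

module Product {q} (𝔽 : FiniteField q) where
  open FiniteField 𝔽
  open IsCommutativeRing isCommutativeRing using (isSemiring; zeroˡ)
    renaming (+-identityˡ to +F-identityˡ; +-identityʳ to +F-identityʳ; *-comm to *F-comm)

  semiring : Semiring _ _
  semiring = record { isSemiring = isSemiring }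

  open Algebra.Properties.Semiring.Sum semiring using (sum; sum-cong-≗; sum-replicate-zero; ∑-distrib-+; ∑-comm; *-distribʳ-sum)

  foldr≡sum : ∀ {n} (f : Fin n → Fin q) → foldr _+F_ 0F (map f (allFin n)) ≡ sum f
  foldr≡sum f = trans (cong (foldr _+F_ 0F) (LP.map-tabulate id f)) (go f)
    where
    go : ∀ {n} (f : Fin n → Fin q) → foldr _+F_ 0F (tabulate f) ≡ sum f
    go {zero}  f = refl
    go {suc n} f = cong (f zero +F_) (go (f ∘ suc))

  ⊗≡sum : ∀ {m n p} (A : Fin m → Fin n → Fin q) (B : Fin n → Fin p → Fin q) i j →
    (A ⊗[ 𝔽 ] B) i j ≡ sum {n} (λ k → A i k *F B k j)
  ⊗≡sum A B i j = foldr≡sum (λ k → A i k *F B k j)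

  ⊗-transpose : ∀ {m n p} (A : Fin m → Fin n → Fin q) (B : Fin n → Fin p → Fin q) j i →
    ((B ᵀ) ⊗[ 𝔽 ] (A ᵀ)) j i ≡ ((A ⊗[ 𝔽 ] B) ᵀ) j i
  ⊗-transpose A B j i = trans (⊗≡sum (B ᵀ) (A ᵀ) j i) (trans (sum-cong-≗ λ k → *F-comm (B k j) (A i k)) (sym (⊗≡sum A B i j)))

  select : ∀ {K} → Maybe (Fin K) → Fin K → Fin q → Fin q
  select nothing   κ v = 0F
  select (just κ₀) κ v = if does (κ₀ F.≟ κ) then v else 0F

  select-* : ∀ {K} k (κ : Fin K) v w → select k κ v *F w ≡ select k κ (v *F w)
  select-* nothing κ v w = zeroˡ w
  select-* (just κ₀) κ v w with does (κ₀ F.≟ κ)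
  ... | true = refl
  ... | false = zeroˡ w

  sum-select : ∀ {K} (κ₀ : Fin K) (f : Fin K → Fin q) → sum (λ κ → select (just κ₀) κ (f κ)) ≡ f κ₀
  sum-select {suc K} zero     f = trans (cong (f zero +F_) (sum-replicate-zero K)) (+F-identityʳ _)
  sum-select {suc K} (suc κ₀) f = trans (+F-identityˡ _) (sum-select κ₀ (f ∘ suc))

  module _ {n K} (key : Fin n → Maybe (Fin K)) (b : Fin n → Fin q)
    (b-key : ∀ {c c′ κ} → key c ≡ just κ → key c′ ≡ just κ → b c ≡ b c′) where

    β : Fin K → Fin q
    β κ = [ (λ _ → 0F) , (λ (c , _) → b c) ]′ (first? λ c → MP.≡-dec F._≟_ (key c) (just κ))

    β-key : ∀ c κ → key c ≡ just κ → b c ≡ β κ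
    β-key c κ eq with first? (λ c → MP.≡-dec F._≟_ (key c) (just κ))
    ... | inj₁ none = ⊥-elim (none c eq)
    ... | inj₂ (c₀ , eq₀ , _) = b-key eq eq₀

    keyless : (Fin n → Fin q) → Maybe (Fin K) → Fin n → Fin q
    keyless a nothing  c = a c *F b c
    keyless a (just _) c = 0F

    -- On the positions with key `κ` the vector `b` has the constant value `β κ`, so by
    -- distributivity they contribute `β κ` times the sum of `a` over them. Of `a` only these sums
    -- matter there.
    dot-split : ∀ a → sum (λ c → a c *F b c) ≡
      sum (λ c → keyless a (key c) c) +F sum (λ κ → sum (λ c → select (key c) κ (a c)) *F β κ)
    dot-split a = begin
      sum (λ c → a c *F b c)
        ≡⟨ sum-cong-≗ (λ c → term c (key c) refl) ⟩
      sum (λ c → keyless a (key c) c +F sum (λ κ → select (key c) κ (a c) *F β κ))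
        ≡⟨ ∑-distrib-+ (λ c → keyless a (key c) c) _ ⟩
      sum (λ c → keyless a (key c) c) +F sum (λ c → sum (λ κ → select (key c) κ (a c) *F β κ))
        ≡⟨ cong (sum (λ c → keyless a (key c) c) +F_) (∑-comm (λ c κ → select (key c) κ (a c) *F β κ)) ⟩
      sum (λ c → keyless a (key c) c) +F sum (λ κ → sum (λ c → select (key c) κ (a c) *F β κ))
        ≡⟨ cong (sum (λ c → keyless a (key c) c) +F_) (sum-cong-≗ λ κ → sym (*-distribʳ-sum (β κ) (λ c → select (key c) κ (a c)))) ⟩
      sum (λ c → keyless a (key c) c) +F sum (λ κ → sum (λ c → select (key c) κ (a c)) *F β κ) ∎
      where
      open ≡-Reasoning
      term : ∀ c k → key c ≡ k → a c *F b c ≡ keyless a k c +F sum (λ κ → select k κ (a c) *F β κ)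
      term c nothing eq = sym (trans (cong ((a c *F b c) +F_)
        (trans (sum-cong-≗ (λ κ → zeroˡ (β κ))) (sum-replicate-zero K))) (+F-identityʳ _))
      term c (just κ₀) eq = sym (trans (+F-identityˡ _) (trans (sum-cong-≗ λ κ → select-* (just κ₀) κ (a c) (β κ))
        (trans (sum-select κ₀ (λ κ → a c *F β κ)) (cong (a c *F_) (sym (β-key c κ₀ eq))))))

    dot-cong : ∀ a a′ → (∀ c → key c ≡ nothing → a c ≡ a′ c) →
      (∀ κ → sum (λ c → select (key c) κ (a c)) ≡ sum (λ c → select (key c) κ (a′ c))) →
      sum (λ c → a c *F b c) ≡ sum (λ c → a′ c *F b c)
    dot-cong a a′ out sums = trans (dot-split a) (trans (cong₂ _+F_
        (sum-cong-≗ λ c → keyless-cong c (key c) refl)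
        (sum-cong-≗ λ κ → cong (_*F β κ) (sums κ))) (sym (dot-split a′)))
      where
      keyless-cong : ∀ c k → key c ≡ k → keyless a k c ≡ keyless a′ k c
      keyless-cong c nothing  eq = cong (_*F b c) (out c eq)
      keyless-cong c (just _) eq = refl

  module _ {m n p} {k₁ k₂ : ℕ} {A : Fin m → Fin n → Fin q} {B : Fin n → Fin p → Fin q}
    {ρ : Fin m → ℕ} {ν : Fin n → ℕ} {γ : Fin p → ℕ} {i}
    (pA : Poor k₁ k₂ A ρ ν i) (pB : ∀ j → Poor k₁ k₂ B ν γ j) where

    private
      Y : Fin k₁ → ℕ
      Y = proj₁ pA
      g : Fin m → Fin k₂
      g = proj₁ (proj₂ pA)
      Z : Fin k₁ → Fin k₁ → ℕ
      Z l = proj₁ (pB (Y l))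
      classB : Fin k₁ → Fin n → Fin k₂
      classB l = proj₁ (proj₂ (pB (Y l)))

      Part : Fin n → Set
      Part c = (∀ l → ν c ≢ Y l) ⊎ ∃[ l ] (ν c ≡ Y l × (∀ l′ → ν c ≡ Y l′ → toℕ l ≤ toℕ l′))

      keyIn : ∀ {c} → Part c → Maybe (Fin (k₁ * k₂))
      keyIn     (inj₁ _)       = nothing
      keyIn {c} (inj₂ (l , _)) = just (combine l (classB l c))

      part : ∀ c → Part c
      part c = first? λ l → ν c N.≟ Y l

      key : Fin n → Maybe (Fin (k₁ * k₂))
      key c = keyIn (part c)

      table : Fin m → Fin k₁ → Fin k₂ → Fin q
      table x l κ = sum λ c → select (key c) (combine l κ) (A x c)

      removed : Σ[ W ∈ (Fin (productRemoved k₁) → ℕ) ] (∀ l l′ (_ : Fin 1) → ∃[ z ] (W z ≡ Z l l′))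
      removed = flatten k₁ k₁ 1 0 λ l l′ _ → Z l l′

    -- Two rows of `A` in the same class agree outside the inner intervals `Y l`. Inside `Y l` the
    -- rows of `B` fall into `k₂` classes with equal entries in column `y`, unless the label of `y`
    -- is removed. With (interval, class) as key, the two dot products agree once the sums over all
    -- keys agree, and `table` stores these.
    poor-product : Poor (productRemoved k₁) (productClasses q k₁ k₂) (A ⊗[ 𝔽 ] B) ρ γ i
    poor-product = proj₁ removed , (λ x → tableCode {k₂} {k₁} {k₂} (g x) (table x)) , same
      where
      same : ∀ x x′ → ρ x ≡ i → ρ x′ ≡ i →
        tableCode {k₂} {k₁} {k₂} (g x) (table x) ≡ tableCode {k₂} {k₁} {k₂} (g x′) (table x′) →
        ∀ y → (∀ l → γ y ≢ proj₁ removed l) → (A ⊗[ 𝔽 ] B) x y ≡ (A ⊗[ 𝔽 ] B) x′ y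
      same x x′ ρx ρx′ eq y out = trans (⊗≡sum A B x y) (trans
        (dot-cong key (λ c → B c y) (λ {c} {c′} → b-key (part c) (part c′)) (A x) (A x′) (λ c → outside (part c)) sums)
        (sym (⊗≡sum A B x′ y)))
        where
        b-key : ∀ {c c′ κ} (s : Part c) (s′ : Part c′) → keyIn s ≡ just κ → keyIn s′ ≡ just κ → B c y ≡ B c′ y
        b-key {c} {c′} (inj₂ (l , νc , _)) (inj₂ (l′ , νc′ , _)) refl eq′
          with FP.combine-injective l′ (classB l′ c′) l (classB l c) (MP.just-injective eq′)
        ... | refl , classes = proj₂ (proj₂ (pB (Y l))) c c′ νc νc′ (sym classes) y λ l′ γy →
          let (z , hit) = proj₂ removed l l′ zero in out z (trans γy (sym hit))
        outside : ∀ {c} (s : Part c) → keyIn s ≡ nothing → A x c ≡ A x′ c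
        outside {c} (inj₁ none) _ = proj₂ (proj₂ pA) x x′ ρx ρx′ (proj₁ (tableCode-injective {k₂} {k₁} {k₂} _ _ (table x) (table x′) eq)) c none
        sums : ∀ κ → sum (λ c → select (key c) κ (A x c)) ≡ sum (λ c → select (key c) κ (A x′ c))
        sums z = subst (λ z → sum (λ c → select (key c) z (A x c)) ≡ sum (λ c → select (key c) z (A x′ c)))
          (FP.combine-remQuot {k₁} k₂ z)
          (proj₂ (tableCode-injective {k₂} {k₁} {k₂} _ _ (table x) (table x′) eq) (proj₁ (remQuot {k₁} k₂ z)) (proj₂ (remQuot {k₁} k₂ z)))

-- Merging the three divisions of a pair of factors down to single intervals.

module Triples {q m n p e} (𝔽 : FiniteField q) (g : ℕ) (large : 32 * (e * e) ≤ g)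
  {A : Fin m → Fin n → Fin q} {B : Fin n → Fin p → Fin q} (SA : Sequence A e) (SB : Sequence B e) where

  open FiniteField 𝔽 using (0F)
  open Product 𝔽

  k₁ k₂ : ℕ
  k₁ = removedParts e g
  k₂ = rowClasses e q

  ε : Fin k₂
  ε = tableCode {2 + e} {2 + e} {e} zero (λ _ _ → 0F)

  -- `r`, `s` and `c` are upper bounds for the labels, which is what the counting asks for; their
  -- sum drops by one at each merge.
  record Triple (r s c : ℕ) (ρ : Fin m → ℕ) (ν : Fin n → ℕ) (γ : Fin p → ℕ) : Set where
    field
      ρ-mono : Monotone ρ
      ν-mono : Monotone ν
      γ-mono : Monotone γ
      ρ< : ∀ x → ρ x < r
      ν< : ∀ x → ν x < s
      γ< : ∀ x → γ x < c
      rowsA : ∀ i → Poor k₁ k₂ A ρ ν i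
      colsA : ∀ i → Poor k₁ k₂ (A ᵀ) ν ρ i
      rowsB : ∀ i → Poor k₁ k₂ B ν γ i
      colsB : ∀ i → Poor k₁ k₂ (B ᵀ) γ ν i

  open Triple

  initial : Triple m n p toℕ toℕ toℕ
  initial = record
    { ρ-mono = id ; ν-mono = id ; γ-mono = id ; ρ< = FP.toℕ<n ; ν< = FP.toℕ<n ; γ< = FP.toℕ<n
    ; rowsA = λ _ → poor-singleton A ε ; colsA = λ _ → poor-singleton (A ᵀ) ε
    ; rowsB = λ _ → poor-singleton B ε ; colsB = λ _ → poor-singleton (B ᵀ) ε }

  ProductDivisions : (Fin m → ℕ) → (Fin p → ℕ) → Set
  ProductDivisions = Divisions (productRemoved k₁) (productClasses q k₁ k₂) (A ⊗[ 𝔽 ] B)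

  division : ∀ {r s c ρ ν γ} → Triple r s c ρ ν γ → Division (productRemoved k₁) (productClasses q k₁ k₂) (A ⊗[ 𝔽 ] B) ρ γ
  division τ = record
    { ρ-mono = ρ-mono τ ; γ-mono = γ-mono τ
    ; rows = λ i → poor-product (rowsA τ i) (rowsB τ)
    ; cols = λ j → poor-cong (⊗-transpose A B) (poor-product (colsB τ j) (colsA τ)) }

  mergeR : ∀ {r s c ρ ν γ} → Triple (suc r) s c ρ ν γ → ∀ {i} → i < r →
    Poor k₁ k₂ A (collapse i ∘ ρ) ν i → Triple r s c (collapse i ∘ ρ) ν γ
  mergeR {r} τ {i} i<r poor = record
    { ρ-mono = collapse-mono i ∘ ρ-mono τ ; ν-mono = ν-mono τ ; γ-mono = γ-mono τ
    ; ρ< = collapse-< i r i<r ∘ ρ< τ ; ν< = ν< τ ; γ< = γ< τ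
    ; rowsA = poor-collapse i (rowsA τ) poor ; colsA = poor-coarsen (collapse i) ∘ colsA τ
    ; rowsB = rowsB τ ; colsB = colsB τ }

  mergeN : ∀ {r s c ρ ν γ} → Triple r (suc s) c ρ ν γ → ∀ {i} → i < s →
    Poor k₁ k₂ (A ᵀ) (collapse i ∘ ν) ρ i → Poor k₁ k₂ B (collapse i ∘ ν) γ i → Triple r s c ρ (collapse i ∘ ν) γ
  mergeN {s = s} τ {i} i<s poorA poorB = record
    { ρ-mono = ρ-mono τ ; ν-mono = collapse-mono i ∘ ν-mono τ ; γ-mono = γ-mono τ
    ; ρ< = ρ< τ ; ν< = collapse-< i s i<s ∘ ν< τ ; γ< = γ< τ
    ; rowsA = poor-coarsen (collapse i) ∘ rowsA τ ; colsA = poor-collapse i (colsA τ) poorA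
    ; rowsB = poor-collapse i (rowsB τ) poorB ; colsB = poor-coarsen (collapse i) ∘ colsB τ }

  mergeC : ∀ {r s c ρ ν γ} → Triple r s (suc c) ρ ν γ → ∀ {i} → i < c →
    Poor k₁ k₂ (B ᵀ) (collapse i ∘ γ) ν i → Triple r s c ρ ν (collapse i ∘ γ)
  mergeC {c = c} τ {i} i<c poor = record
    { ρ-mono = ρ-mono τ ; ν-mono = ν-mono τ ; γ-mono = collapse-mono i ∘ γ-mono τ
    ; ρ< = ρ< τ ; ν< = ν< τ ; γ< = collapse-< i c i<c ∘ γ< τ
    ; rowsA = rowsA τ ; colsA = colsA τ
    ; rowsB = poor-coarsen (collapse i) ∘ rowsB τ ; colsB = poor-collapse i (colsB τ) poor }

  exceptionalPairs : ∀ {m n} {M : Fin m → Fin n → Fin q} → Sequence M e → ∀ {ρ ν} → Monotone ρ → Monotone ν →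
    ∀ s → (∀ c → ν c < s) → ∃[ K ] (8 * length K ≤ s + 16 × (∀ i → i ∉ K → Poor k₁ k₂ M (collapse (i + i) ∘ ρ) ν (i + i)))
  exceptionalPairs S ρ-mono ν-mono s ν<s with Exceptional.exceptional g 0F S (⌊n/2⌋-mono ∘ ρ-mono) ν-mono s ν<s large
  ... | K , len , poor = K , len , λ i i∉K → poor-pair ([ (λ i∈K → ⊥-elim (i∉K i∈K)) , id ]′ (poor i))

  one-list : ∀ s k t → s ≤ t → k ≤ s + 16 → k ≤ (t + t) + 32
  one-list s k t s≤t k≤ = ≤-trans k≤ (+-mono-≤ (≤-trans s≤t (m≤m+n t t)) (m≤m+n 16 16))

  -- An inner merge has to be poor in `A` and in `B` at once, so two exceptional lists add up. This
  -- is why `avoid-pair` allows twice the side plus 32.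
  two-lists : ∀ r c a b t → r ≤ t → c ≤ t → 8 * a ≤ r + 16 → 8 * b ≤ c + 16 → 8 * (a + b) ≤ (t + t) + 32
  two-lists r c a b t r≤t c≤t a≤ b≤ = ≤-trans (≤-reflexive (*-distribˡ-+ 8 a b))
    (≤-trans (+-mono-≤ a≤ b≤) (≤-trans (≤-reflexive (shape r c)) (+-monoˡ-≤ 32 (+-mono-≤ r≤t c≤t))))
    where
    shape : ∀ r c → (r + 16) + (c + 16) ≡ (r + c) + 32
    shape = NS.solve-∀

  bigR : ∀ {r s c ρ ν γ} → Triple (suc r) s c ρ ν γ → 20 ≤ suc r → s ≤ suc r →
    ∃[ i ] Triple r s c (collapse i ∘ ρ) ν γ
  bigR {r} {s} τ big s≤r with exceptionalPairs SA (ρ-mono τ) (ν-mono τ) s (ν< τ)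
  ... | K , len , poor with avoid-pair r K big (one-list s (8 * length K) (suc r) s≤r len)
  ... | i , i< , i∉K = i + i , mergeR τ i< (poor i i∉K)

  bigC : ∀ {r s c ρ ν γ} → Triple r s (suc c) ρ ν γ → 20 ≤ suc c → s ≤ suc c →
    ∃[ i ] Triple r s c ρ ν (collapse i ∘ γ)
  bigC {s = s} {c} τ big s≤c with exceptionalPairs (transpose SB) (γ-mono τ) (ν-mono τ) s (ν< τ)
  ... | K , len , poor with avoid-pair c K big (one-list s (8 * length K) (suc c) s≤c len)
  ... | i , i< , i∉K = i + i , mergeC τ i< (poor i i∉K)

  bigN : ∀ {r s c ρ ν γ} → Triple r (suc s) c ρ ν γ → 20 ≤ suc s → r ≤ suc s → c ≤ suc s →
    ∃[ i ] Triple r s c ρ (collapse i ∘ ν) γ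
  bigN {r} {s} {c} τ big r≤s c≤s
    with exceptionalPairs (transpose SA) (ν-mono τ) (ρ-mono τ) r (ρ< τ) | exceptionalPairs SB (ν-mono τ) (γ-mono τ) c (γ< τ)
  ... | K , len , poor | K′ , len′ , poor′
    with avoid-pair s (K ++ K′) big (subst (λ k → 8 * k ≤ _) (sym (LP.length-++ K)) (two-lists r c (length K) (length K′) (suc s) r≤s c≤s len len′))
  ... | i , i< , i∉K = i + i , mergeN τ i< (poor i (i∉K ∘ ∈-++⁺ˡ)) (poor′ i (i∉K ∘ ∈-++⁺ʳ K))

  few : ∀ {m n} (M : Fin m → Fin n → Fin q) {ρ ν i s} → s ≤ 20 → (∀ c → ν c < s) → Poor k₁ k₂ M ρ ν i
  few M s≤20 ν<s = poor-few ((2 + e) * e * suc g) 20 M ε λ c → ≤-trans (ν<s c) s≤20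

  data Merged (r s c : ℕ) (ρ : Fin m → ℕ) (ν : Fin n → ℕ) (γ : Fin p → ℕ) : Set where
    finished : r ≤ 1 → c ≤ 1 → Merged r s c ρ ν γ
    rows : ∀ {r′} → r ≡ suc r′ → ∀ i → Triple r′ s c (collapse i ∘ ρ) ν γ → Merged r s c ρ ν γ
    mids : ∀ {s′} → s ≡ suc s′ → ∀ i → Triple r s′ c ρ (collapse i ∘ ν) γ → Merged r s c ρ ν γ
    cols : ∀ {c′} → c ≡ suc c′ → ∀ i → Triple r s c′ ρ ν (collapse i ∘ γ) → Merged r s c ρ ν γ

  -- With at most 20 inner labels, all of them can be removed, so any rows of `A` and any columns of
  -- `B` may be merged. The product sees only these two sides, so the inner one may stay as it is.
  small : ∀ {r s c ρ ν γ} → Triple r s c ρ ν γ → s ≤ 20 → Merged r s c ρ ν γ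
  small {suc (suc r)} τ s≤ = rows refl 0 (mergeR τ (s≤s z≤n) (few A s≤ (ν< τ)))
  small {zero} {c = suc (suc c)} τ s≤ = cols refl 0 (mergeC τ (s≤s z≤n) (few (B ᵀ) s≤ (ν< τ)))
  small {suc zero} {c = suc (suc c)} τ s≤ = cols refl 0 (mergeC τ (s≤s z≤n) (few (B ᵀ) s≤ (ν< τ)))
  small {zero} {c = zero} τ s≤ = finished z≤n z≤n
  small {zero} {c = suc zero} τ s≤ = finished z≤n ≤-refl
  small {suc zero} {c = zero} τ s≤ = finished ≤-refl z≤n
  small {suc zero} {c = suc zero} τ s≤ = finished ≤-refl ≤-refl

  -- Once s exceeds 20, a side at least as long as the sides opposite to it is merged: there the
  -- exceptional pairs are too few to block it.
  merge : ∀ {r s c ρ ν γ} → Triple r s c ρ ν γ → Merged r s c ρ ν γ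
  merge {s = zero} τ = small τ z≤n
  merge {r} {suc s} {c} τ with suc s ≤? 20 | r ≤? suc s | c ≤? suc s
  ... | yes s≤ | _ | _ = small τ s≤
  ... | no s≰ | yes r≤ | yes c≤ = let (i , τ′) = bigN τ (<⇒≤ (≰⇒> s≰)) r≤ c≤ in mids refl i τ′
  ... | no s≰ | no r≰ | _ = mergeLargeR τ (<⇒≤ (<-trans (≰⇒> s≰) (≰⇒> r≰))) (<⇒≤ (≰⇒> r≰))
    where
    mergeLargeR : ∀ {r s c ρ ν γ} → Triple r s c ρ ν γ → 20 ≤ r → s ≤ r → Merged r s c ρ ν γ
    mergeLargeR {suc r} τ big s≤ = let (i , τ′) = bigR τ big s≤ in rows refl i τ′
  ... | no s≰ | yes r≤ | no c≰ = mergeLargeC τ (<⇒≤ (<-trans (≰⇒> s≰) (≰⇒> c≰))) (<⇒≤ (≰⇒> c≰))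
    where
    mergeLargeC : ∀ {r s c ρ ν γ} → Triple r s c ρ ν γ → 20 ≤ c → s ≤ c → Merged r s c ρ ν γ
    mergeLargeC {c = suc c} τ big s≤ = let (i , τ′) = bigC τ big s≤ in cols refl i τ′

  divisions : ∀ fuel {r s c ρ ν γ} → Triple r s c ρ ν γ → r + s + c ≤ fuel → ProductDivisions ρ γ
  divisions fuel τ le with merge τ
  divisions fuel τ le | finished r≤ c≤ = stop (division τ)
    (λ x → n<1⇒n≡0 (≤-trans (ρ< τ x) r≤)) (λ y → n<1⇒n≡0 (≤-trans (γ< τ y) c≤))
  divisions (suc fuel) τ (s≤s le) | rows refl i τ′ = mergeRows (division τ) i (divisions fuel τ′ le)
  -- An inner merge leaves `ρ` and `γ` unchanged and so adds no constructor.
  divisions (suc fuel) {r} {s} {c} τ le | mids {s′} refl i τ′ = divisions fuel τ′ (≤-pred (subst (λ k → k + c ≤ suc fuel) (+-suc r s′) le))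
  divisions (suc fuel) {r} {s} τ le | cols {c′} refl i τ′ = mergeCols (division τ) i (divisions fuel τ′ (≤-pred (subst (_≤ suc fuel) (+-suc (r + s) c′) le)))
  divisions zero {r} {s} τ le | mids {s′} refl i τ′ = ⊥-elim (n≮0 (≤-trans (≤-trans (m≤n+m (suc s′) r) (m≤m+n _ _)) le))
  divisions zero {r} {s} τ le | cols {c′} refl i τ′ = ⊥-elim (n≮0 (≤-trans (m≤n+m (suc c′) (r + s)) le))

  product-divisions : ProductDivisions toℕ toℕ
  product-divisions = divisions (m + n + p) initial ≤-refl

-- From divisions to contraction sequences

-- The search runs over the finitely many codes; decoding returns a function only up to pointwise
-- equality, so `X` has to respect it.
any-function? : ∀ {m ℓ} {X : (Fin m → Fin ℓ) → Set} → (∀ {f g} → (∀ x → f x ≡ g x) → X f → X g) →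
  (∀ f → Dec (X f)) → Dec (Σ _ X)
any-function? {m} {ℓ} resp X? = map′ (λ (k , p) → finToFun k , p)
  (λ (f , p) → funToFin f , resp (λ x → sym (FP.finToFun-funToFin f x)) p)
  (FP.any? λ k → X? (finToFun {ℓ} {m} k))

representatives : ∀ {m k} {X : Fin m → Set} → (∀ x → Dec (X x)) → (g : Fin m → Fin k) →
  ∃[ L ] (length L ≤ k × (∀ x → X x → ∃[ z ] (z ∈ L × X z × g z ≡ g x)))
representatives {m} {k} {X} X? g = let (L , len , all) = go (allFin k) in
  L , ≤-trans len (≤-reflexive (LP.length-tabulate {n = k} id)) , λ x p → all x p (∈-tabulate⁺ (g x))
  where
  go : ∀ ks → ∃[ L ] (length L ≤ length ks × (∀ x → X x → g x ∈ ks → ∃[ z ] (z ∈ L × X z × g z ≡ g x)))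
  go [] = [] , z≤n , λ _ _ ()
  go (κ ∷ ks) with go ks | FP.any? (λ x → X? x ×-dec (g x F.≟ κ))
  ... | L , len , all | yes (z , p , gz) = z ∷ L , s≤s len , λ
    { x q (here eq) → z , here refl , p , trans gz (sym eq)
    ; x q (there g∈) → let (z , z∈ , r) = all x q g∈ in z , there z∈ , r }
  ... | L , len , all | no none = L , m≤n⇒m≤1+n len , λ
    { x q (here eq) → ⊥-elim (none (x , q , eq))
    ; x q (there g∈) → all x q g∈ }

gather : ∀ {X : Set} k b (F : Fin k → List X) → (∀ l → length (F l) ≤ b) →
  ∃[ L ] (length L ≤ k * b × (∀ l {z} → z ∈ F l → z ∈ L))
gather zero b F _ = [] , z≤n , λ ()
gather (suc k) b F len with gather k b (F ∘ suc) (len ∘ suc)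
... | L , lenL , all = F zero ++ L , ≤-trans (≤-reflexive (LP.length-++ (F zero))) (+-mono-≤ (len zero) lenL) , λ
  { zero z∈ → ∈-++⁺ˡ z∈ ; (suc l) z∈ → ∈-++⁺ʳ (F zero) (all l z∈) }

-- `k₂` distinct rows over `q` letters leave at most `q ^ k₂` distinct columns. The sum bounds both
-- numbers, so that goodness of a cell is symmetric under transposition.
cellBound : ℕ → ℕ → ℕ
cellBound q k₂ = k₂ + q ^ k₂

classBound : ℕ → ℕ → ℕ → ℕ
classBound q k₁ k₂ = k₂ * cellBound q k₂ ^ (k₁ * 1)

module Cells {q} (ε : Fin q) (k₁ k₂ : ℕ) where

  ℓ classes : ℕ
  ℓ = cellBound q k₂
  classes = classBound q k₁ k₂

  FewRows : ∀ {m n} → (Fin m → Fin n → Fin q) → (Fin m → ℕ) → (Fin n → ℕ) → ℕ → ℕ → Set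
  FewRows {m} M ρ γ i j = Σ[ g ∈ (Fin m → Fin ℓ) ]
    (∀ x x′ → ρ x ≡ i → ρ x′ ≡ i → g x ≡ g x′ → ∀ c → γ c ≡ j → M x c ≡ M x′ c)

  Good : ∀ {m n} → (Fin m → Fin n → Fin q) → (Fin m → ℕ) → (Fin n → ℕ) → ℕ → ℕ → Set
  Good M ρ γ i j = FewRows M ρ γ i j × FewRows (M ᵀ) γ ρ j i

  module _ {m n} (M : Fin m → Fin n → Fin q) (ρ : Fin m → ℕ) (γ : Fin n → ℕ) where

    fewRows? : ∀ i j → Dec (FewRows M ρ γ i j)
    fewRows? i j = any-function?
      (λ f≗g X x x′ ρx ρx′ eq → X x x′ ρx ρx′ (trans (f≗g x) (trans eq (sym (f≗g x′)))))
      λ g → FP.all? λ x → FP.all? λ x′ → (ρ x N.≟ i) →-dec ((ρ x′ N.≟ i) →-dec ((g x F.≟ g x′) →-dec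
        FP.all? λ c → (γ c N.≟ j) →-dec (M x c F.≟ M x′ c)))

  good? : ∀ {m n} (M : Fin m → Fin n → Fin q) ρ γ i j → Dec (Good M ρ γ i j)
  good? M ρ γ i j = fewRows? M ρ γ i j ×-dec fewRows? (M ᵀ) γ ρ j i

  fewRows-refine : ∀ {m n} (M : Fin m → Fin n → Fin q) {ρ γ} (f h : ℕ → ℕ) {i j} →
    FewRows M (f ∘ ρ) (h ∘ γ) (f i) (h j) → FewRows M ρ γ i j
  fewRows-refine M f h (g , same) = g , λ x x′ ρx ρx′ gx c γc → same x x′ (cong f ρx) (cong f ρx′) gx c (cong h γc)

  good-refine : ∀ {m n} (M : Fin m → Fin n → Fin q) {ρ γ} (f h : ℕ → ℕ) {i j} →
    Good M (f ∘ ρ) (h ∘ γ) (f i) (h j) → Good M ρ γ i j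
  good-refine M f h (r , c) = fewRows-refine M f h r , fewRows-refine (M ᵀ) h f c

  -- Agreement is demanded on good cells only: this leaves boundedly many classes in a poor
  -- interval, yet makes the entries of a good cell depend only on the classes.
  SameRow : ∀ {m n} → (Fin m → Fin n → Fin q) → (Fin m → ℕ) → (Fin n → ℕ) → Fin m → Fin m → Set
  SameRow M ρ γ x x′ = ρ x ≡ ρ x′ × (∀ c → M x c ≡ M x′ c ⊎ ¬ Good M ρ γ (ρ x) (γ c))

  module _ {m n} {M : Fin m → Fin n → Fin q} {ρ : Fin m → ℕ} {γ : Fin n → ℕ} where

    sameRow? : ∀ x x′ → Dec (SameRow M ρ γ x x′)
    sameRow? x x′ = (ρ x N.≟ ρ x′) ×-dec FP.all? λ c → (M x c F.≟ M x′ c) ⊎-dec ¬? (good? M ρ γ (ρ x) (γ c))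

    sameRow-refl : ∀ {x} → SameRow M ρ γ x x
    sameRow-refl = refl , λ _ → inj₁ refl

    sameRow-sym : ∀ {x x′} → SameRow M ρ γ x x′ → SameRow M ρ γ x′ x
    sameRow-sym (ρ≡ , same) = sym ρ≡ , λ c → S.map sym (λ bad → bad ∘ subst (λ i → Good M ρ γ i (γ c)) (sym ρ≡)) (same c)

    sameRow-trans : ∀ {x x′ x″} → SameRow M ρ γ x x′ → SameRow M ρ γ x′ x″ → SameRow M ρ γ x x″
    sameRow-trans {x} {x′} {x″} (ρ≡ , same) (ρ≡′ , same′) = trans ρ≡ ρ≡′ , λ c → join′ c (same c) (same′ c)
      where
      join′ : ∀ c → M x c ≡ M x′ c ⊎ ¬ Good M ρ γ (ρ x) (γ c) → M x′ c ≡ M x″ c ⊎ ¬ Good M ρ γ (ρ x′) (γ c) →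
        M x c ≡ M x″ c ⊎ ¬ Good M ρ γ (ρ x) (γ c)
      join′ c (inj₂ bad) _ = inj₂ bad
      join′ c (inj₁ eq) (inj₁ eq′) = inj₁ (trans eq eq′)
      join′ c (inj₁ _) (inj₂ bad) = inj₂ (bad ∘ subst (λ i → Good M ρ γ i (γ c)) ρ≡)

    -- A cell inside a good cell is good. Coarsening therefore creates no new cells on which
    -- agreement could fail.
    sameRow-coarsen : ∀ (f h : ℕ → ℕ) {x x′} → SameRow M ρ γ x x′ → SameRow M (f ∘ ρ) (h ∘ γ) x x′
    sameRow-coarsen f h (ρ≡ , same) = cong f ρ≡ , λ c → S.map₂ (λ bad → bad ∘ good-refine M f h) (same c)

    -- At a label that is not removed, the cell has at most `k₂` distinct rows, and a column is
    -- determined by its entries in one row of each class.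
    good-or-removed : ∀ {i} (poor : Poor k₁ k₂ M ρ γ i) → ∀ j → (∃[ l ] (proj₁ poor l ≡ j)) ⊎ Good M ρ γ i j
    good-or-removed {i} (Y , g , same) j with FP.any? (λ l → Y l N.≟ j)
    ... | yes hit = inj₁ hit
    ... | no miss = inj₂ (((λ x → g x ↑ˡ q ^ k₂) , rows) , ((λ y → k₂ ↑ʳ column y) , cols))
      where
      out : ∀ {c} → γ c ≡ j → ∀ l → γ c ≢ Y l
      out γc l eq = miss (l , trans (sym eq) γc)
      rows : ∀ x x′ → ρ x ≡ i → ρ x′ ≡ i → g x ↑ˡ q ^ k₂ ≡ g x′ ↑ˡ q ^ k₂ → ∀ c → γ c ≡ j → M x c ≡ M x′ c
      rows x x′ ρx ρx′ eq c γc = same x x′ ρx ρx′ (FP.↑ˡ-injective (q ^ k₂) (g x) (g x′) eq) c (out γc)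
      Row : Fin k₂ → Fin m → Set
      Row κ x = ρ x ≡ i × g x ≡ κ
      row : ∀ κ → (∀ x → ¬ Row κ x) ⊎ ∃[ x ] (Row κ x × (∀ y → Row κ y → toℕ x ≤ toℕ y))
      row κ = first? λ x → (ρ x N.≟ i) ×-dec (g x F.≟ κ)
      entryAt : ∀ {κ} → (∀ x → ¬ Row κ x) ⊎ ∃[ x ] (Row κ x × (∀ y → Row κ y → toℕ x ≤ toℕ y)) → Fin n → Fin q
      entryAt (inj₁ _)       y = ε
      entryAt (inj₂ (x , _)) y = M x y
      column : Fin n → Fin (q ^ k₂)
      column y = funToFin λ κ → entryAt (row κ) y
      entry-row : ∀ {κ} o x → Row κ x → ∀ y → γ y ≡ j → entryAt {κ} o y ≡ M x y
      entry-row (inj₁ none) x rx y γy = ⊥-elim (none x rx)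
      entry-row (inj₂ (x₀ , (ρ₀ , g₀) , _)) x (ρx , gx) y γy = same x₀ x ρ₀ ρx (trans g₀ (sym gx)) y (out γy)
      cols : ∀ y y′ → γ y ≡ j → γ y′ ≡ j → k₂ ↑ʳ column y ≡ k₂ ↑ʳ column y′ → ∀ x → ρ x ≡ i → M x y ≡ M x y′
      cols y y′ γy γy′ eq x ρx = trans (sym (entry-row (row (g x)) x (ρx , refl) y γy))
        (trans (funToFin-injective (λ κ → entryAt (row κ) y) (λ κ → entryAt (row κ) y′)
          (FP.↑ʳ-injective k₂ (column y) (column y′) eq) (g x))
        (entry-row (row (g x)) x (ρx , refl) y′ γy′))

    -- Off the removed labels the class `g` determines a row. In each of the `k₁` removed cells the
    -- row is determined by its class there if the cell is good, and is ignored otherwise.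
    row-representatives : ∀ {i} → Poor k₁ k₂ M ρ γ i →
      ∃[ L ] (length L ≤ classes × (∀ x → ρ x ≡ i → ∃[ z ] (z ∈ L × SameRow M ρ γ z x)))
    row-representatives {i} (Y , g , same) =
      let (L , len , all) = representatives (λ x → ρ x N.≟ i) code
      in L , len , λ x ρx → let (z , z∈ , ρz , eq) = all x ρx in z , z∈ , same-code z x ρz ρx eq
      where
      cellCode : ∀ {j} → Dec (Good M ρ γ i j) → Fin m → Fin ℓ
      cellCode (yes ((h , _) , _)) x = h x
      -- A placeholder: `SameRow` asks nothing in a cell that is not good.
      cellCode (no _)              x = g x ↑ˡ q ^ k₂
      table : Fin m → Fin k₁ → Fin 1 → Fin ℓ
      table x l _ = cellCode (good? M ρ γ i (Y l)) x
      code : Fin m → Fin classes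
      code x = tableCode {k₂} {k₁} {1} (g x) (table x)
      inCell : ∀ {j} (d : Dec (Good M ρ γ i j)) → ∀ z x → ρ z ≡ i → ρ x ≡ i → cellCode d z ≡ cellCode d x → ∀ c → γ c ≡ j →
        M z c ≡ M x c ⊎ ¬ Good M ρ γ i j
      inCell (yes ((h , same) , _)) z x ρz ρx eq c γc = inj₁ (same z x ρz ρx eq c γc)
      inCell (no bad) z x ρz ρx eq c γc = inj₂ bad
      same-code : ∀ z x → ρ z ≡ i → ρ x ≡ i → code z ≡ code x → SameRow M ρ γ z x
      same-code z x ρz ρx eq = trans ρz (sym ρx) , entries
        where
        eqs : g z ≡ g x × (∀ l k → table z l k ≡ table x l k)
        eqs = tableCode-injective {k₂} {k₁} {1} (g z) (g x) (table z) (table x) eq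
        entries : ∀ c → M z c ≡ M x c ⊎ ¬ Good M ρ γ (ρ z) (γ c)
        entries c with FP.any? (λ l → γ c N.≟ Y l)
        ... | no none = inj₁ (same z x ρz ρx (proj₁ eqs) c λ l γc → none (l , γc))
        ... | yes (l , γc) = S.map₂ (λ bad → bad ∘ subst₂ (Good M ρ γ) ρz γc)
          (inCell (good? M ρ γ i (Y l)) z x ρz ρx (proj₂ eqs l zero) c γc)

-- Refining a chain of equivalences into single merges.

record Equivalence (N : ℕ) : Set₁ where
  field
    _~_     : Fin N → Fin N → Set
    _~?_    : ∀ x y → Dec (x ~ y)
    ~-refl  : ∀ {x} → x ~ x
    ~-sym   : ∀ {x y} → x ~ y → y ~ x
    ~-trans : ∀ {x y z} → x ~ y → y ~ z → x ~ z

open Equivalence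

infix 4 _⊑_ _⊒_

_⊑_ : ∀ {N} → Equivalence N → Partition N → Set
Q ⊑ f = ∀ {x y} → _~_ Q x y → f x ≡ f y

_⊒_ : ∀ {N} → Equivalence N → Partition N → Set
Q ⊒ f = ∀ {x y} → f x ≡ f y → _~_ Q x y

-- `Ok` is required of all partitions between consecutive equivalences, so the merges leading from
-- one to the next can be made in any order.
data Chain {N} (Ok : Partition N → Set) (Q : Equivalence N) : Set₁ where
  last : (∀ f → Q ⊑ f → Ok f) → Chain Ok Q
  link : ∀ Q′ → (∀ {x y} → _~_ Q x y → _~_ Q′ x y) → (∀ f → Q ⊑ f → Q′ ⊒ f → Ok f) → Chain Ok Q′ → Chain Ok Q

data Run {N} (Ok : Partition N → Set) : ℕ → Partition N → Set where
  end  : ∀ {f} → Trivial f → Ok f → Run Ok 0 f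
  step : ∀ {k f g} → Ok f → MergeOf f g → Run Ok k g → Run Ok (suc k) f

module Glue {k} {a b : Fin (suc (suc k))} (a≢b : a ≢ b) where

  b≢a : b ≢ a
  b≢a = a≢b ∘ sym

  glueAt : ∀ w → Dec (w ≡ b) → Fin (suc k)
  glueAt w (yes _)  = punchOut b≢a
  glueAt w (no w≢b) = punchOut (w≢b ∘ sym)

  glue : Fin (suc (suc k)) → Fin (suc k)
  glue w = glueAt w (w F.≟ b)

  glueAt-ab : ∀ d d′ → glueAt a d ≡ glueAt b d′
  glueAt-ab (yes eq) _ = ⊥-elim (a≢b eq)
  glueAt-ab (no _) (no b≢b) = ⊥-elim (b≢b refl)
  glueAt-ab (no _) (yes _) = FP.punchOut-cong b refl

  glue-inv : ∀ v w d d′ → glueAt v d ≡ glueAt w d′ → v ≡ w ⊎ (v ≡ a × w ≡ b) ⊎ (v ≡ b × w ≡ a)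
  glue-inv v w (yes p) (yes q)  eq = inj₁ (trans p (sym q))
  glue-inv v w (yes p) (no w≢b) eq = inj₂ (inj₂ (p , sym (FP.punchOut-injective b≢a (w≢b ∘ sym) eq)))
  glue-inv v w (no v≢b) (yes q) eq = inj₂ (inj₁ (FP.punchOut-injective (v≢b ∘ sym) b≢a eq , q))
  glue-inv v w (no v≢b) (no w≢b) eq = inj₁ (FP.punchOut-injective (v≢b ∘ sym) (w≢b ∘ sym) eq)

  glue-surjective : ∀ w → ∃[ v ] (glue v ≡ w)
  glue-surjective w = punchIn b w , at (punchIn b w F.≟ b)
    where
    at : ∀ d → glueAt (punchIn b w) d ≡ w
    at (yes eq) = ⊥-elim (FP.punchInᵢ≢i b w eq)
    at (no ne)  = trans (FP.punchOut-cong b refl) (FP.punchOut-punchIn b)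

module _ {N} {Ok : Partition N → Set} where

  Below : ∀ {Q} → Partition N → Chain Ok Q → Set
  Below f (last _)        = ⊤
  Below f (link Q′ _ _ _) = Q′ ⊒ f

  Surjective : ∀ {k} → (Fin N → Fin k) → Set
  Surjective f = ∀ w → ∃[ x ] (f x ≡ w)

  module Merge {k} (f : Fin N → Fin (suc (suc k))) (f-surj : Surjective f) {x y} (x≢y : f x ≢ f y) where
    open Glue x≢y

    merged : Fin N → Fin (suc k)
    merged = glue ∘ f

    merged-surj : Surjective merged
    merged-surj w = let (v , gv) = glue-surjective w ; (u , fu) = f-surj v in u , trans (cong glue fu) gv

    merged-inv : ∀ u v → merged u ≡ merged v → f u ≡ f v ⊎ (f u ≡ f x × f v ≡ f y) ⊎ (f u ≡ f y × f v ≡ f x)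
    merged-inv u v = glue-inv (f u) (f v) (f u F.≟ f y) (f v F.≟ f y)

    merged-xy : merged x ≡ merged y
    merged-xy = glueAt-ab (f x F.≟ f y) (f y F.≟ f y)

    merges : MergeOf (toℕ ∘ f) (toℕ ∘ merged)
    merges = x , y , x≢y ∘ FP.toℕ-injective , λ u v →
      ( (λ eq → S.map (cong toℕ) (S.map (λ (p , q) → cong toℕ p , cong toℕ q) (λ (p , q) → cong toℕ p , cong toℕ q))
          (merged-inv u v (FP.toℕ-injective eq)))
      , λ { (inj₁ eq) → cong (toℕ ∘ glue) (FP.toℕ-injective eq)
          ; (inj₂ (inj₁ (p , q))) → cong toℕ (trans (cong glue (FP.toℕ-injective p)) (trans merged-xy (cong glue (sym (FP.toℕ-injective q)))))
          ; (inj₂ (inj₂ (p , q))) → cong toℕ (trans (cong glue (FP.toℕ-injective p)) (trans (sym merged-xy) (cong glue (sym (FP.toℕ-injective q))))) } )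

    above : ∀ {Q} → Q ⊑ toℕ ∘ f → Q ⊑ toℕ ∘ merged
    above Q⊑f eq = cong (toℕ ∘ glue) (FP.toℕ-injective (Q⊑f eq))

    below : ∀ {Q} → Q ⊒ toℕ ∘ f → _~_ Q x y → Q ⊒ toℕ ∘ merged
    below {Q} Q⊒f xy {u} {v} eq with merged-inv u v (FP.toℕ-injective eq)
    ... | inj₁ p = Q⊒f (cong toℕ p)
    ... | inj₂ (inj₁ (p , q)) = ~-trans Q (Q⊒f (cong toℕ p)) (~-trans Q xy (Q⊒f (cong toℕ (sym q))))
    ... | inj₂ (inj₂ (p , q)) = ~-trans Q (Q⊒f (cong toℕ p)) (~-trans Q (~-sym Q xy) (Q⊒f (cong toℕ (sym q))))

  -- A surjection onto `Fin (suc k)` has exactly `suc k` parts, so exactly `k` merges remain. Two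
  -- parts related by the next equivalence are merged as long as there are any; otherwise the chain
  -- advances.
  build : ∀ {Q} k (f : Fin N → Fin (suc k)) → Surjective f → (C : Chain Ok Q) → Q ⊑ toℕ ∘ f → Below (toℕ ∘ f) C → Run Ok k (toℕ ∘ f)
  build zero f surj (last ok) Q⊑f _ = end (λ x y → cong toℕ (single (f x) (f y))) (ok _ Q⊑f)
    where
    single : ∀ (u v : Fin 1) → u ≡ v
    single zero zero = refl
  build {Q} (suc k) f surj (last ok) Q⊑f _ =
    let (x , fx) = surj zero ; (y , fy) = surj (suc zero)
        open Merge f surj {x} {y} (λ eq → case trans (sym fx) (trans eq fy) of λ ())
    in step (ok _ Q⊑f) merges (build {Q} k merged merged-surj (last ok) (above {Q} Q⊑f) tt)
  build {Q} k f surj (link Q′ sub ok C) Q⊑f f⊑Q′ with FP.any? (λ x → FP.any? λ y → _~?_ Q′ x y ×-dec ¬? (f x F.≟ f y))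
  build {Q} (suc k) f surj (link Q′ sub ok C) Q⊑f f⊑Q′ | yes (x , y , xy , x≢y) =
    let open Merge f surj x≢y
    in step (ok _ Q⊑f f⊑Q′) merges (build {Q} k merged merged-surj (link Q′ sub ok C) (above {Q} Q⊑f) (below {Q′} f⊑Q′ xy))
  build zero f surj (link Q′ sub ok C) Q⊑f f⊑Q′ | yes (x , y , xy , x≢y) = ⊥-elim (x≢y (single (f x) (f y)))
    where
    single : ∀ (u v : Fin 1) → u ≡ v
    single zero zero = refl
  -- Elements related by `Q′` now share a part, and conversely by the invariant: the partition is
  -- `Q′` itself.
  ... | no none = build {Q′} k f surj C
    (λ {x} {y} xy → cong toℕ (decidable-stable (f x F.≟ f y) λ ne → none (x , y , xy , ne))) (belowNext C)
    where
    belowNext : (C : Chain Ok Q′) → Below (toℕ ∘ f) C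
    belowNext (last _)          = tt
    belowNext (link Q″ sub′ _ _) = λ eq → sub′ (f⊑Q′ eq)

  at : ∀ {k f} → Run Ok k f → ℕ → Partition N
  at {f = f} _          zero    = f
  at {f = f} (end _ _)  (suc i) = f
  at (step _ _ r)       (suc i) = at r i

  at-merge : ∀ {k f} (r : Run Ok k f) i → i < k → MergeOf (at r i) (at r (suc i))
  at-merge (step _ m (end _ _))    zero    _        = m
  at-merge (step _ m (step _ _ _)) zero    _        = m
  at-merge (step _ _ r)            (suc i) (s≤s lt) = at-merge r i lt

  at-trivial : ∀ {k f} (r : Run Ok k f) → Trivial (at r k)
  at-trivial (end t _)    = t
  at-trivial (step _ _ r) = at-trivial r

  at-ok : ∀ {k f} (r : Run Ok k f) i → i ≤ k → Ok (at r i)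
  at-ok (end _ ok)    zero    _        = ok
  at-ok (step ok _ _) zero    _        = ok
  at-ok (step _ _ r)  (suc i) (s≤s le) = at-ok r i le

record PartitionSequence {N} (Ok : Partition N → Set) : Set where
  field
    P      : ℕ → Partition N
    start  : Discrete (P 0)
    steps  : ∀ i → suc i < N → MergeOf (P i) (P (suc i))
    finish : Trivial (P (N ∸ 1))
    ok     : ∀ i → i < N → Ok (P i)

partitionSequence : ∀ {N} {Ok : Partition N → Set} {Q} → Chain Ok Q → (∀ {x y} → _~_ Q x y → x ≡ y) → PartitionSequence Ok
partitionSequence {zero} C discrete = record
  { P = λ _ () ; start = λ () ; steps = λ _ () ; finish = λ () ; ok = λ _ () }
partitionSequence {suc N} {Ok} {Q} C discrete = record
  { P = at run ; start = λ x y → FP.toℕ-injective ; steps = λ { i (s≤s lt) → at-merge run i lt }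
  ; finish = at-trivial run ; ok = λ { i (s≤s le) → at-ok run i le } }
  where
  belowId : (C : Chain Ok Q) → Below toℕ C
  belowId (last _) = tt
  belowId (link Q′ _ _ _) eq with FP.toℕ-injective eq
  ... | refl = ~-refl Q′
  run : Run Ok N toℕ
  run = build N id (λ w → w , refl) C (λ xy → cong toℕ (discrete xy)) (belowId C)

-- An interval of the coarser division consists of at most two finer ones, hence `c + c`
-- representatives. They are taken for the interval of the part itself and for `k₁` removed
-- intervals of the other side.
degreeBound : ℕ → ℕ → ℕ → ℕ
degreeBound q k₁ k₂ = let c = classBound q k₁ k₂ in (c + c) + k₁ * (c + c)

assemble : ∀ {a b N} (inl : Fin a → Fin N) (inr : Fin b → Fin N) k c (L : List (Fin a)) (F : Fin k → List (Fin b)) →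
  length L ≤ c → (∀ l → length (F l) ≤ c) →
  ∃[ Z ] (length Z ≤ c + k * c × (∀ {z} → z ∈ L → inl z ∈ Z) × (∀ l {z} → z ∈ F l → inr z ∈ Z))
assemble inl inr k c L F lenL lenF =
  let (G , lenG , all) = gather k c F lenF
  in map inl L ++ map inr G ,
    ≤-trans (≤-reflexive (trans (LP.length-++ (map inl L)) (cong₂ _+_ (LP.length-map inl L) (LP.length-map inr G)))) (+-mono-≤ lenL lenG) ,
    (λ z∈ → ∈-++⁺ˡ (∈-map⁺ inl z∈)) , λ l z∈ → ∈-++⁺ʳ (map inl L) (∈-map⁺ inr (all l z∈))

-- Atomic types of pairs of rows and columns.

module AtomicTypes {q m p} (M : Fin m → Fin p → Fin q) where

  data View : Fin (m + p) → Set where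
    row : ∀ r → View (r ↑ˡ p)
    col : ∀ c → View (m ↑ʳ c)

  view : ∀ x → View x
  view x = subst View (FP.join-splitAt m p x) (of (splitAt m x))
    where
    of : ∀ e → View (join m p e)
    of (inj₁ r) = row r
    of (inj₂ c) = col c

  private
    tuple : ∀ {a a′ b b′ c c′ d d′ : Bool} {e e′ f f′ : Maybe (Fin q)} →
      a ≡ a′ → b ≡ b′ → c ≡ c′ → d ≡ d′ → e ≡ e′ → f ≡ f′ → (a , b , c , d , e , f) ≡ (a′ , b′ , c′ , d′ , e′ , f′)
    tuple refl refl refl refl refl refl = refl

    isRow-row : ∀ r → isRow {m} {p} (r ↑ˡ p) ≡ true
    isRow-row r rewrite FP.splitAt-↑ˡ m r p = refl

    isRow-col : ∀ c → isRow {m} {p} (m ↑ʳ c) ≡ false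
    isRow-col c rewrite FP.splitAt-↑ʳ m p c = refl

    entry-rows : ∀ r r′ → entry M (r ↑ˡ p) (r′ ↑ˡ p) ≡ nothing
    entry-rows r r′ rewrite FP.splitAt-↑ˡ m r p | FP.splitAt-↑ˡ m r′ p = refl

    entry-cols : ∀ c c′ → entry M (m ↑ʳ c) (m ↑ʳ c′) ≡ nothing
    entry-cols c c′ rewrite FP.splitAt-↑ʳ m p c = refl

    entry-col-row : ∀ c r → entry M (m ↑ʳ c) (r ↑ˡ p) ≡ nothing
    entry-col-row c r rewrite FP.splitAt-↑ʳ m p c = refl

    before : ∀ {x y : Fin (m + p)} → toℕ x < toℕ y → does (x F.<? y) ≡ true
    before {x} {y} = dec-true (x F.<? y)

    after : ∀ {x y : Fin (m + p)} → toℕ x < toℕ y → does (y F.<? x) ≡ false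
    after {x} {y} lt = dec-false (y F.<? x) (<⇒≯ lt)

    rows-< : ∀ {r r′ : Fin m} → toℕ r < toℕ r′ → toℕ (r ↑ˡ p) < toℕ (r′ ↑ˡ p)
    rows-< {r} {r′} = subst₂ _<_ (sym (FP.toℕ-↑ˡ r p)) (sym (FP.toℕ-↑ˡ r′ p))

    cols-< : ∀ {c c′ : Fin p} → toℕ c < toℕ c′ → toℕ (m ↑ʳ c) < toℕ (m ↑ʳ c′)
    cols-< {c} {c′} lt = subst₂ _<_ (sym (FP.toℕ-↑ʳ m c)) (sym (FP.toℕ-↑ʳ m c′)) (+-monoʳ-< m lt)

    row-col-< : ∀ (r : Fin m) (c : Fin p) → toℕ (r ↑ˡ p) < toℕ (m ↑ʳ c)
    row-col-< r c = subst₂ _<_ (sym (FP.toℕ-↑ˡ r p)) (sym (FP.toℕ-↑ʳ m c)) (≤-trans (FP.toℕ<n r) (m≤m+n m (toℕ c)))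

  atp-rows-< : ∀ {r r′} → toℕ r < toℕ r′ → atp M (r ↑ˡ p) (r′ ↑ˡ p) ≡ (true , true , true , false , nothing , nothing)
  atp-rows-< {r} {r′} lt = tuple (isRow-row r) (isRow-row r′) (before (rows-< lt)) (after (rows-< lt)) (entry-rows r r′) (entry-rows r′ r)

  atp-rows-> : ∀ {r r′} → toℕ r′ < toℕ r → atp M (r ↑ˡ p) (r′ ↑ˡ p) ≡ (true , true , false , true , nothing , nothing)
  atp-rows-> {r} {r′} lt = tuple (isRow-row r) (isRow-row r′) (after (rows-< lt)) (before (rows-< lt)) (entry-rows r r′) (entry-rows r′ r)

  atp-cols-< : ∀ {c c′} → toℕ c < toℕ c′ → atp M (m ↑ʳ c) (m ↑ʳ c′) ≡ (false , false , true , false , nothing , nothing)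
  atp-cols-< {c} {c′} lt = tuple (isRow-col c) (isRow-col c′) (before (cols-< lt)) (after (cols-< lt)) (entry-cols c c′) (entry-cols c′ c)

  atp-cols-> : ∀ {c c′} → toℕ c′ < toℕ c → atp M (m ↑ʳ c) (m ↑ʳ c′) ≡ (false , false , false , true , nothing , nothing)
  atp-cols-> {c} {c′} lt = tuple (isRow-col c) (isRow-col c′) (after (cols-< lt)) (before (cols-< lt)) (entry-cols c c′) (entry-cols c′ c)

  atp-row-col : ∀ r c → atp M (r ↑ˡ p) (m ↑ʳ c) ≡ (true , false , true , false , just (M r c) , nothing)
  atp-row-col r c = tuple (isRow-row r) (isRow-col c) (before (row-col-< r c)) (after (row-col-< r c)) (entry-row-col M r c) (entry-col-row c r)

  atp-col-row : ∀ r c → atp M (m ↑ʳ c) (r ↑ˡ p) ≡ (false , true , false , true , nothing , just (M r c))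
  atp-col-row r c = tuple (isRow-col c) (isRow-row r) (after (row-col-< r c)) (before (row-col-< r c)) (entry-col-row c r) (entry-row-col M r c)

-- Red degree of partitions between consecutive divisions.

module Contraction {q} (ε : Fin q) (k₁ k₂ : ℕ) {m p} (M : Fin m → Fin p → Fin q) where
  open Cells ε k₁ k₂
  open AtomicTypes M

  SameElement : (Fin m → ℕ) → (Fin p → ℕ) → Fin m ⊎ Fin p → Fin m ⊎ Fin p → Set
  SameElement ρ γ (inj₁ x) (inj₁ x′) = SameRow M ρ γ x x′
  SameElement ρ γ (inj₂ y) (inj₂ y′) = SameRow (M ᵀ) γ ρ y y′
  SameElement ρ γ _        _         = ⊥

  equivalence : (Fin m → ℕ) → (Fin p → ℕ) → Equivalence (m + p)
  equivalence ρ γ = record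
    { _~_ = λ x y → SameElement ρ γ (splitAt m x) (splitAt m y)
    ; _~?_ = λ x y → dec (splitAt m x) (splitAt m y)
    ; ~-refl = λ {x} → rfl (splitAt m x)
    ; ~-sym = λ {x} {y} → symm (splitAt m x) (splitAt m y)
    ; ~-trans = λ {x} {y} {z} → tran (splitAt m x) (splitAt m y) (splitAt m z)
    }
    where
    dec : ∀ x y → Dec (SameElement ρ γ x y)
    dec (inj₁ x) (inj₁ x′) = sameRow? x x′
    dec (inj₂ y) (inj₂ y′) = sameRow? y y′
    dec (inj₁ _) (inj₂ _)  = no λ ()
    dec (inj₂ _) (inj₁ _)  = no λ ()
    rfl : ∀ x → SameElement ρ γ x x
    rfl (inj₁ x) = sameRow-refl
    rfl (inj₂ y) = sameRow-refl
    symm : ∀ x y → SameElement ρ γ x y → SameElement ρ γ y x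
    symm (inj₁ x) (inj₁ x′) = sameRow-sym
    symm (inj₂ y) (inj₂ y′) = sameRow-sym
    tran : ∀ x y z → SameElement ρ γ x y → SameElement ρ γ y z → SameElement ρ γ x z
    tran (inj₁ _) (inj₁ _) (inj₁ _) = sameRow-trans
    tran (inj₂ _) (inj₂ _) (inj₂ _) = sameRow-trans

  equivalence-coarsen : ∀ {ρ γ} (f h : ℕ → ℕ) {x y} →
    _~_ (equivalence ρ γ) x y → _~_ (equivalence (f ∘ ρ) (h ∘ γ)) x y
  equivalence-coarsen f h {x} {y} = go (splitAt m x) (splitAt m y)
    where
    go : ∀ x y → SameElement _ _ x y → SameElement (f ∘ _) (h ∘ _) x y
    go (inj₁ x) (inj₁ x′) = sameRow-coarsen f h
    go (inj₂ y) (inj₂ y′) = sameRow-coarsen h f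

  equivalence-discrete : ∀ {x y} → _~_ (equivalence toℕ toℕ) x y → x ≡ y
  equivalence-discrete {x} {y} eq = trans (sym (FP.join-splitAt m p x))
    (trans (cong (join m p) (go (splitAt m x) (splitAt m y) eq)) (FP.join-splitAt m p y))
    where
    go : ∀ x y → SameElement toℕ toℕ x y → x ≡ y
    go (inj₁ x) (inj₁ x′) (eq , _) = cong inj₁ (FP.toℕ-injective eq)
    go (inj₂ y) (inj₂ y′) (eq , _) = cong inj₂ (FP.toℕ-injective eq)

  -- Pass from (`a`, `b`) to (`r`, `b`) by the row relation, then to (`r`, `c`) by the column
  -- relation; both moves stay in the same good cell.
  constant-on-good : ∀ {ρ γ r a c b} → Good M ρ γ (ρ r) (γ c) → SameRow M ρ γ a r → SameRow (M ᵀ) γ ρ b c → M a b ≡ M r c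
  constant-on-good {ρ} {γ} {r} {a} {c} {b} good (ρ≡ , sameA) (γ≡ , sameB) = trans
    ([ id , (λ bad → ⊥-elim (bad (subst₂ (Good M ρ γ) (sym ρ≡) (sym γ≡) good))) ]′ (sameA b))
    ([ id , (λ bad → ⊥-elim (bad (swap (subst (Good M ρ γ (ρ r)) (sym γ≡) good)))) ]′ (sameB r))

  -- Satisfied by `collapse i` and by the identity, so one argument handles row merges and column
  -- merges. A label `i` can arise only from `i` and `suc i`.
  Shrinks : (ℕ → ℕ) → Set
  Shrinks f = ∀ a → f a ≡ a ⊎ suc (f a) ≡ a

  collapse-shrinks : ∀ i → Shrinks (collapse i)
  collapse-shrinks i a = S.map proj₁ proj₁ (collapse-inv i a)

  pair-representatives : ∀ {m n} {M : Fin m → Fin n → Fin q} {ρ : Fin m → ℕ} {γ : Fin n → ℕ} {f} → (∀ i → Poor k₁ k₂ M ρ γ i) → Shrinks f → ∀ i →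
    ∃[ L ] (length L ≤ classes + classes × (∀ x → f (ρ x) ≡ i → ∃[ z ] (z ∈ L × SameRow M ρ γ z x)))
  pair-representatives {m} {n} {M} {ρ} {γ} {f} poor shrinks i = both (row-representatives {M = M} (poor i)) (row-representatives {M = M} (poor (suc i)))
    where
    Representatives : ℕ → Set
    Representatives i = ∃[ L ] (length L ≤ classes × (∀ x → ρ x ≡ i → ∃[ z ] (z ∈ L × SameRow M ρ γ z x)))
    both : Representatives i → Representatives (suc i) →
      ∃[ L ] (length L ≤ classes + classes × (∀ x → f (ρ x) ≡ i → ∃[ z ] (z ∈ L × SameRow M ρ γ z x)))
    both (L , len , all) (L′ , len′ , all′) =
      L ++ L′ , ≤-trans (≤-reflexive (LP.length-++ L)) (+-mono-≤ len len′) , represented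
      where
      represented : ∀ x → f (ρ x) ≡ i → ∃[ z ] (z ∈ L ++ L′ × SameRow M ρ γ z x)
      represented x eq with shrinks (ρ x)
      ... | inj₁ same = let (z , z∈ , s) = all x (trans (sym same) eq) in z , ∈-++⁺ˡ z∈ , s
      ... | inj₂ next = let (z , z∈ , s) = all′ x (trans (sym next) (cong suc eq)) in z , ∈-++⁺ʳ L z∈ , s

  module Between {ρ γ f h} (D : Division k₁ k₂ M ρ γ) (f-shrinks : Shrinks f) (h-shrinks : Shrinks h)
    (D′ : Division k₁ k₂ M (f ∘ ρ) (h ∘ γ)) (P : Partition (m + p))
    (above : equivalence ρ γ ⊑ P) (below : equivalence (f ∘ ρ) (h ∘ γ) ⊒ P) where
    private
      module D = Division D
      module D′ = Division D′

    above-row : ∀ {z x} → SameRow M ρ γ z x → P (z ↑ˡ p) ≡ P (x ↑ˡ p)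
    above-row {z} {x} s = above (subst₂ (SameElement ρ γ) (sym (FP.splitAt-↑ˡ m z p)) (sym (FP.splitAt-↑ˡ m x p)) s)

    above-col : ∀ {z y} → SameRow (M ᵀ) γ ρ z y → P (m ↑ʳ z) ≡ P (m ↑ʳ y)
    above-col {z} {y} s = above (subst₂ (SameElement ρ γ) (sym (FP.splitAt-↑ʳ m p z)) (sym (FP.splitAt-↑ʳ m p y)) s)

    below-row : ∀ u r → P u ≡ P (r ↑ˡ p) → ∃[ a ] (u ≡ a ↑ˡ p × SameRow M (f ∘ ρ) (h ∘ γ) a r)
    below-row u r eq with view u | subst (SameElement (f ∘ ρ) (h ∘ γ) (splitAt m u)) (FP.splitAt-↑ˡ m r p) (below eq)
    ... | row a | s = a , refl , subst (λ e → SameElement (f ∘ ρ) (h ∘ γ) e (inj₁ r)) (FP.splitAt-↑ˡ m a p) s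
    ... | col c | s = ⊥-elim (subst (λ e → SameElement (f ∘ ρ) (h ∘ γ) e (inj₁ r)) (FP.splitAt-↑ʳ m p c) s)

    below-col : ∀ u c → P u ≡ P (m ↑ʳ c) → ∃[ b ] (u ≡ m ↑ʳ b × SameRow (M ᵀ) (h ∘ γ) (f ∘ ρ) b c)
    below-col u c eq with view u | subst (SameElement (f ∘ ρ) (h ∘ γ) (splitAt m u)) (FP.splitAt-↑ʳ m p c) (below eq)
    ... | col b | s = b , refl , subst (λ e → SameElement (f ∘ ρ) (h ∘ γ) e (inj₂ c)) (FP.splitAt-↑ʳ m p b) s
    ... | row a | s = ⊥-elim (subst (λ e → SameElement (f ∘ ρ) (h ∘ γ) e (inj₂ c)) (FP.splitAt-↑ˡ m a p) s)

    -- Parts in different intervals of the coarser division lie entirely one before the other, so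
    -- all pairs between them have the same atomic type.
    red-rows : ∀ r r′ → RedAdj M P (r ↑ˡ p) (r′ ↑ˡ p) → f (ρ r′) ≡ f (ρ r)
    red-rows r r′ (_ , u , u′ , v , v′ , pu , pu′ , pv , pv′ , differ)
      with below-row u r pu | below-row u′ r pu′ | below-row v r′ pv | below-row v′ r′ pv′
    ... | a , refl , (la , _) | a′ , refl , (la′ , _) | b , refl , (lb , _) | b′ , refl , (lb′ , _)
      with <-cmp (f (ρ r)) (f (ρ r′))
    ... | tri≈ _ eq _ = sym eq
    ... | tri< lt _ _ = ⊥-elim (differ (trans
            (atp-rows-< (monotone-reflects-< D′.ρ-mono (subst₂ _<_ (sym la) (sym lb) lt)))
            (sym (atp-rows-< (monotone-reflects-< D′.ρ-mono (subst₂ _<_ (sym la′) (sym lb′) lt))))))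
    ... | tri> _ _ gt = ⊥-elim (differ (trans
            (atp-rows-> (monotone-reflects-< D′.ρ-mono (subst₂ _<_ (sym lb) (sym la) gt)))
            (sym (atp-rows-> (monotone-reflects-< D′.ρ-mono (subst₂ _<_ (sym lb′) (sym la′) gt))))))

    red-cols : ∀ c c′ → RedAdj M P (m ↑ʳ c) (m ↑ʳ c′) → h (γ c′) ≡ h (γ c)
    red-cols c c′ (_ , u , u′ , v , v′ , pu , pu′ , pv , pv′ , differ)
      with below-col u c pu | below-col u′ c pu′ | below-col v c′ pv | below-col v′ c′ pv′
    ... | a , refl , (la , _) | a′ , refl , (la′ , _) | b , refl , (lb , _) | b′ , refl , (lb′ , _)
      with <-cmp (h (γ c)) (h (γ c′))
    ... | tri≈ _ eq _ = sym eq
    ... | tri< lt _ _ = ⊥-elim (differ (trans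
            (atp-cols-< (monotone-reflects-< D′.γ-mono (subst₂ _<_ (sym la) (sym lb) lt)))
            (sym (atp-cols-< (monotone-reflects-< D′.γ-mono (subst₂ _<_ (sym la′) (sym lb′) lt))))))
    ... | tri> _ _ gt = ⊥-elim (differ (trans
            (atp-cols-> (monotone-reflects-< D′.γ-mono (subst₂ _<_ (sym lb) (sym la) gt)))
            (sym (atp-cols-> (monotone-reflects-< D′.γ-mono (subst₂ _<_ (sym lb′) (sym la′) gt))))))

    red-row-col : ∀ r c → RedAdj M P (r ↑ˡ p) (m ↑ʳ c) → ¬ Good M (f ∘ ρ) (h ∘ γ) (f (ρ r)) (h (γ c))
    red-row-col r c (_ , u , u′ , v , v′ , pu , pu′ , pv , pv′ , differ) good
      with below-row u r pu | below-row u′ r pu′ | below-col v c pv | below-col v′ c pv′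
    ... | a , refl , sa | a′ , refl , sa′ | b , refl , sb | b′ , refl , sb′ = differ (trans (atp-row-col a b) (trans
      (cong (λ e → true , false , true , false , just e , nothing) (trans (constant-on-good good sa sb) (sym (constant-on-good good sa′ sb′))))
      (sym (atp-row-col a′ b′))))

    red-col-row : ∀ c r → RedAdj M P (m ↑ʳ c) (r ↑ˡ p) → ¬ Good M (f ∘ ρ) (h ∘ γ) (f (ρ r)) (h (γ c))
    red-col-row c r (_ , u , u′ , v , v′ , pu , pu′ , pv , pv′ , differ) good
      with below-col u c pu | below-col u′ c pu′ | below-row v r pv | below-row v′ r pv′
    ... | b , refl , sb | b′ , refl , sb′ | a , refl , sa | a′ , refl , sa′ = differ (trans (atp-col-row a b) (trans
      (cong (λ e → false , true , false , true , nothing , just e) (trans (constant-on-good good sa sb) (sym (constant-on-good good sa′ sb′))))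
      (sym (atp-col-row a′ b′))))

    RedNeighbours : Fin (m + p) → Set
    RedNeighbours x = ∃[ L ] (length L ≤ degreeBound q k₁ k₂ × (∀ y → RedAdj M P x y → ∃[ z ] (z ∈ L × P z ≡ P y)))

    -- Parts of `P` refine the coarser classes, so the coarser division tells which intervals can
    -- contain red neighbours. Finer classes lie inside parts of `P`, so the finer division supplies
    -- representatives of these neighbours.
    row-neighbours : ∀ r → RedNeighbours (r ↑ˡ p)
    row-neighbours r = proj₁ lists , proj₁ (proj₂ lists) , λ y → covered (view y)
      where
      i : ℕ
      i = f (ρ r)
      Y : Fin k₁ → ℕ
      Y = proj₁ (D′.rows i)
      R = pair-representatives {M = M} D.rows f-shrinks i
      C : ∀ l → _
      C l = pair-representatives {M = M ᵀ} D.cols h-shrinks (Y l)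
      lists = assemble (_↑ˡ p) (m ↑ʳ_) k₁ (classes + classes) (proj₁ R) (λ l → proj₁ (C l)) (proj₁ (proj₂ R)) (λ l → proj₁ (proj₂ (C l)))
      in-rows : ∀ x → f (ρ x) ≡ i → ∃[ z ] (z ∈ proj₁ lists × P z ≡ P (x ↑ˡ p))
      in-rows x eq = let (z , z∈ , s) = proj₂ (proj₂ R) x eq in z ↑ˡ p , proj₁ (proj₂ (proj₂ lists)) z∈ , above-row s
      in-cols : ∀ y l → h (γ y) ≡ Y l → ∃[ z ] (z ∈ proj₁ lists × P z ≡ P (m ↑ʳ y))
      in-cols y l eq = let (z , z∈ , s) = proj₂ (proj₂ (C l)) y eq in m ↑ʳ z , proj₂ (proj₂ (proj₂ lists)) l z∈ , above-col s
      covered : ∀ {y} → View y → RedAdj M P (r ↑ˡ p) y → ∃[ z ] (z ∈ proj₁ lists × P z ≡ P y)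
      covered (row r′) red = in-rows r′ (red-rows r r′ red)
      covered (col c)  red = [ (λ (l , eq) → in-cols c l (sym eq)) , (λ good → ⊥-elim (red-row-col r c red good)) ]′
        (good-or-removed {M = M} (D′.rows i) (h (γ c)))

    col-neighbours : ∀ c → RedNeighbours (m ↑ʳ c)
    col-neighbours c = proj₁ lists , proj₁ (proj₂ lists) , λ y → covered (view y)
      where
      j : ℕ
      j = h (γ c)
      Y : Fin k₁ → ℕ
      Y = proj₁ (D′.cols j)
      C = pair-representatives {M = M ᵀ} D.cols h-shrinks j
      R : ∀ l → _
      R l = pair-representatives {M = M} D.rows f-shrinks (Y l)
      lists = assemble (m ↑ʳ_) (_↑ˡ p) k₁ (classes + classes) (proj₁ C) (λ l → proj₁ (R l)) (proj₁ (proj₂ C)) (λ l → proj₁ (proj₂ (R l)))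
      in-cols : ∀ y → h (γ y) ≡ j → ∃[ z ] (z ∈ proj₁ lists × P z ≡ P (m ↑ʳ y))
      in-cols y eq = let (z , z∈ , s) = proj₂ (proj₂ C) y eq in m ↑ʳ z , proj₁ (proj₂ (proj₂ lists)) z∈ , above-col s
      in-rows : ∀ x l → f (ρ x) ≡ Y l → ∃[ z ] (z ∈ proj₁ lists × P z ≡ P (x ↑ˡ p))
      in-rows x l eq = let (z , z∈ , s) = proj₂ (proj₂ (R l)) x eq in z ↑ˡ p , proj₂ (proj₂ (proj₂ lists)) l z∈ , above-row s
      covered : ∀ {y} → View y → RedAdj M P (m ↑ʳ c) y → ∃[ z ] (z ∈ proj₁ lists × P z ≡ P y)
      covered (col c′) red = in-cols c′ (red-cols c c′ red)
      covered (row r)  red = [ (λ (l , eq) → in-rows r l (sym eq)) , (λ good → ⊥-elim (red-col-row c r red (swap good))) ]′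
        (good-or-removed {M = M ᵀ} (D′.cols j) (f (ρ r)))

    between : RedDegreeAtMost M P (degreeBound q k₁ k₂)
    between x with view x
    ... | row r = row-neighbours r
    ... | col c = col-neighbours c

  -- With one interval on each side, the representatives of both meet every part of `P`, so the
  -- number of all parts is bounded.
  top : ∀ {ρ γ} → Division k₁ k₂ M ρ γ → (∀ x → ρ x ≡ 0) → (∀ y → γ y ≡ 0) → (P : Partition (m + p)) →
    equivalence ρ γ ⊑ P → RedDegreeAtMost M P (degreeBound q k₁ k₂)
  top {ρ} {γ} D ρ≡0 γ≡0 P above x = Rs ++ Cs , len , λ y _ → covered (view y)
    where
    R = row-representatives {M = M} (Division.rows D 0)
    C = row-representatives {M = M ᵀ} (Division.cols D 0)
    Rs = map (_↑ˡ p) (proj₁ R)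
    Cs = map (m ↑ʳ_) (proj₁ C)
    len : length (Rs ++ Cs) ≤ degreeBound q k₁ k₂
    len = ≤-trans (≤-reflexive (trans (LP.length-++ Rs) (cong₂ _+_ (LP.length-map (_↑ˡ p) (proj₁ R)) (LP.length-map (m ↑ʳ_) (proj₁ C)))))
      (≤-trans (+-mono-≤ (proj₁ (proj₂ R)) (proj₁ (proj₂ C))) (m≤m+n (classes + classes) (k₁ * (classes + classes))))
    covered : ∀ {y} → View y → ∃[ z ] (z ∈ Rs ++ Cs × P z ≡ P y)
    covered (row r) = let (z , z∈ , s) = proj₂ (proj₂ R) r (ρ≡0 r) in z ↑ˡ p , ∈-++⁺ˡ (∈-map⁺ (_↑ˡ p) z∈) ,
      above (subst₂ (SameElement ρ γ) (sym (FP.splitAt-↑ˡ m z p)) (sym (FP.splitAt-↑ˡ m r p)) s)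
    covered (col c) = let (z , z∈ , s) = proj₂ (proj₂ C) c (γ≡0 c) in m ↑ʳ z , ∈-++⁺ʳ Rs (∈-map⁺ (m ↑ʳ_) z∈) ,
      above (subst₂ (SameElement ρ γ) (sym (FP.splitAt-↑ʳ m p z)) (sym (FP.splitAt-↑ʳ m p c)) s)

  division : ∀ {ρ γ} → Divisions k₁ k₂ M ρ γ → Division k₁ k₂ M ρ γ
  division (stop D _ _)      = D
  division (mergeRows D _ _) = D
  division (mergeCols D _ _) = D

  Bounded : Partition (m + p) → Set
  Bounded P = RedDegreeAtMost M P (degreeBound q k₁ k₂)

  chain : ∀ {ρ γ} → Divisions k₁ k₂ M ρ γ → Chain Bounded (equivalence ρ γ)
  chain (stop D ρ≡0 γ≡0) = last (top D ρ≡0 γ≡0)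
  chain {ρ} {γ} (mergeRows D i Ds) = link (equivalence (collapse i ∘ ρ) γ)
    (λ {x} {y} → equivalence-coarsen {ρ} {γ} (collapse i) id {x} {y})
    (λ P a b → Between.between {f = collapse i} {h = id} D (collapse-shrinks i) (λ _ → inj₁ refl) (division Ds) P a b) (chain Ds)
  chain {ρ} {γ} (mergeCols D j Ds) = link (equivalence ρ (collapse j ∘ γ))
    (λ {x} {y} → equivalence-coarsen {ρ} {γ} id (collapse j) {x} {y})
    (λ P a b → Between.between {f = id} {h = collapse j} D (λ _ → inj₁ refl) (collapse-shrinks j) (division Ds) P a b) (chain Ds)

  contraction : Divisions k₁ k₂ M toℕ toℕ → ContractionSeq M (degreeBound q k₁ k₂)
  contraction Ds = record { P = P ; start = start ; step = steps ; finish = finish ; width = ok }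
    where open PartitionSequence (partitionSequence {Q = equivalence toℕ toℕ} (chain Ds) (λ {x} {y} → equivalence-discrete {x} {y}))

-- The explicit bound and its application to the product.

twinWidthBound : ℕ → ℕ → ℕ → ℕ
twinWidthBound dA dB q = degreeBound q (productRemoved k₁) (productClasses q k₁ k₂)
  where
  e k₁ k₂ : ℕ
  -- The sum dominates both twin-widths, and the successor counts the part itself. Below,
  -- `32 * (e * e)` is the least value of `g` that the counting of exceptional labels admits.
  e = suc (dA + dB)
  k₁ = removedParts e (32 * (e * e))
  k₂ = rowClasses e q

theorem45 : Σ (ℕ → ℕ → ℕ → ℕ) λ f →
    ∀ (q : ℕ) → IsPrimePower q → (𝔽 : FiniteField q) →
    ∀ {m n p} (A : Matrix (Fin q) m n) (B : Matrix (Fin q) n p) →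
    ∀ (dA dB : ℕ) → TwwIs A dA → TwwIs B dB →
    TwwAtMost (A ⊗[ 𝔽 ] B) (f dA dB q)
theorem45 = twinWidthBound , λ q _ 𝔽 A B dA dB (SA , _) (SB , _) →
  Contraction.contraction (FiniteField.0F 𝔽) _ _ (A ⊗[ 𝔽 ] B)
    (Triples.product-divisions 𝔽 _ ≤-refl (toSequence SA (m≤m+n dA dB)) (toSequence SB (m≤n+m dB dA)))
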